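{- Let $k\ge 2$ be a fixed integer. For each positive integer $n$, place $n^{k-1}$ line-rooks at random on the $k$-dimensional chessboard with side length $n$. Then, as $n\to\infty$, the expected proportion of safe spaces converges to $1/e^k$.
   Context: The $k$-dimensional board of side length $n$ is the set of spaces $\{1,\dots,n\}^k$. "Placing $n^{k-1}$ pieces at random" means that the set of occupied spaces (the board configuration) is chosen uniformly among all $\binom{n^k}{n^{k-1}}$ subsets of $n^{k-1}$ distinct spaces. A line-rook attacks every space that agrees with its position in all but one coordinate. A space is safe under a board configuration if it is neither occupied nor attacked by any of the placed pieces. The expected proportion of safe spaces is the expected number of safe spaces divided by $n^k$. -}

module Defs where

open import Data.Fin.Base using (Fin; finToFun)
open import Data.Fin.Properties using (all?; any?) renaming (_≟_ to _≟ᶠ_)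
open import Data.Fin.Subset using (Subset; inside; outside; _∈_; _∉_; ∣_∣)
open import Data.Fin.Subset.Properties using (_∈?_)
open import Data.Integer.Base using (+_)
open import Data.List.Base using (List; []; _∷_; _++_; map; filter; length; allFin)
open import Data.Nat.Base as ℕ using (ℕ; zero; suc; NonZero; z≤n; s≤s; _!)
import Data.Nat.Properties as ℕₚ
import Data.Integer.Base as ℤ
import Data.Integer.Properties as ℤₚ
open import Data.Product.Base using (∃-syntax; _×_; _,_; proj₁; proj₂)
open import Data.Rational.Base as ℚ
  using (ℚ; mkℚ; 0ℚ; 1ℚ; _/_; _+_; _-_; _*_; -_; _≤_; _<_; Positive)
  renaming (∣_∣ to ∣_∣ℚ)
import Data.Rational.Properties as ℚₚ
open import Data.Rational.Unnormalised.Base as ℚᵘ using (mkℚᵘ)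
import Data.Rational.Unnormalised.Properties as ℚᵘₚ
open import Data.Rational.Solver using (module +-*-Solver)
open import Data.Sum.Base using (_⊎_; inj₁; inj₂)
import Data.Vec.Base as Vec
open import Relation.Binary.PropositionalEquality
open import Relation.Nullary.Decidable using (Dec; yes; no; ¬?; _×-dec_; _→-dec_)
open import Relation.Nullary.Negation using (¬_; contradiction)

-- `finToFun` is the library's bijection between Fin (n ^ k) and
-- Fin k → Fin n.  Indexing spaces by Fin (n ^ k) lets sets of spaces be
-- the library's `Subset`.
Space : ℕ → ℕ → Set
Space k n = Fin (n ℕ.^ k)

coord : ∀ {k n} → Space k n → Fin k → Fin n
coord = finToFun

Board : ℕ → ℕ → Set
Board k n = Subset (n ℕ.^ k)

Attacks : ∀ {k n} → Space k n → Space k n → Set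
Attacks {k} {n} y x =
  ∃[ i ] coord {k} {n} y i ≢ coord {k} {n} x i ×
         (∀ j → j ≢ i → coord {k} {n} y j ≡ coord {k} {n} x j)

Safe : ∀ k n → Board k n → Space k n → Set
Safe k n B x = x ∉ B × (∀ y → y ∈ B → ¬ Attacks {k} {n} y x)

attacks? : ∀ {k n} (y x : Space k n) → Dec (Attacks {k} {n} y x)
attacks? {k} {n} y x = any? λ i →
  ¬? (coord {k} {n} y i ≟ᶠ coord {k} {n} x i) ×-dec
  all? (λ j → ¬? (j ≟ᶠ i) →-dec (coord {k} {n} y j ≟ᶠ coord {k} {n} x j))

safe? : ∀ k n (B : Board k n) (x : Space k n) → Dec (Safe k n B x)
safe? k n B x = ¬? (x ∈? B) ×-dec
  all? (λ y → (y ∈? B) →-dec ¬? (attacks? {k} {n} y x))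

safeCount : ∀ k n → Board k n → ℕ
safeCount k n B = length (filter (safe? k n B) (allFin (n ℕ.^ k)))

-- Every subset of Fin n, exactly once.
allSubsets : ∀ n → List (Subset n)
allSubsets zero    = Vec.[] ∷ []
allSubsets (suc n) = map (inside Vec.∷_)  (allSubsets n) ++
                     map (outside Vec.∷_) (allSubsets n)

configurations : ∀ k n → List (Board k n)
configurations k n =
  filter (λ B → ∣ B ∣ ℕₚ.≟ n ℕ.^ (k ℕ.∸ 1)) (allSubsets (n ℕ.^ k))

sumℚ : List ℚ → ℚ
sumℚ []       = 0ℚ
sumℚ (q ∷ qs) = q + sumℚ qs

-- Expectation of f when the outcome is uniform on a list of outcomes
-- without repetitions.  The value at [] is a convention; for k, n ≥ 1
-- there is at least one configuration, since n ^ (k ∸ 1) ≤ n ^ k.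
expectation : ∀ {A : Set} → List A → (A → ℚ) → ℚ
expectation []         f = 0ℚ
expectation xs@(_ ∷ _) f = sumℚ (map f xs) * (+ 1 / length xs)

expectedSafe : ℕ → ℕ → ℚ
expectedSafe k n =
  expectation (configurations k n) (λ B → + safeCount k n B / 1)

expectedSafeProportion : ∀ k n .{{_ : NonZero n}} → ℚ
expectedSafeProportion k n =
  expectedSafe k n * (+ 1 / n ℕ.^ k) {{ℕₚ.m^n≢0 n k}}

IsCauchy : (ℕ → ℚ) → Set
IsCauchy s = ∀ ε → 0ℚ < ε →
  ∃[ N ] (∀ m n → N ℕ.≤ m → N ℕ.≤ n → ∣ s m - s n ∣ℚ < ε)

-- Not quotiented: different sequences may represent the same real.
record ℝ : Set where
  constructor mkℝ
  field
    seq    : ℕ → ℚ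
    cauchy : IsCauchy seq
open ℝ public

module RationalLemmas where
  0<⇒pos : ∀ {p} → 0ℚ < p → Positive p
  0<⇒pos = ℚ.positive

  0<+ : ∀ {p q} → 0ℚ < p → 0ℚ < q → 0ℚ < p + q
  0<+ = ℚₚ.+-mono-<

  0<* : ∀ {p q} → 0ℚ < p → 0ℚ < q → 0ℚ < p * q
  0<* {p} {q} 0<p 0<q = subst (_< p * q) (ℚₚ.*-zeroʳ p)
    (ℚₚ.*-monoʳ-<-pos p {{0<⇒pos 0<p}} 0<q)

  0<1/ : ∀ {p} (0<p : 0ℚ < p) → 0ℚ < (ℚ.1/ p) {{ℚ.>-nonZero 0<p}}
  0<1/ {p} 0<p = ℚₚ.positive⁻¹ _ {{ℚₚ.1/pos⇒pos p {{0<⇒pos 0<p}}}}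

  0<1 : 0ℚ < 1ℚ
  0<1 = ℚₚ.positive⁻¹ 1ℚ

  -- It suffices to bound the differences by a constant multiple of ε.
  cauchy-scaled : ∀ {s} C → 0ℚ < C →
    (∀ ε → 0ℚ < ε →
      ∃[ N ] (∀ m n → N ℕ.≤ m → N ℕ.≤ n → ∣ s m - s n ∣ℚ < C * ε)) →
    IsCauchy s
  cauchy-scaled C 0<C h ε 0<ε with h ((ℚ.1/ C) {{ℚ.>-nonZero 0<C}} * ε) (0<* (0<1/ 0<C) 0<ε)
  ... | N , p = N , λ m n N≤m N≤n → subst (_ <_) eq (p m n N≤m N≤n)
    where
    instance _ = ℚ.>-nonZero 0<C
    eq : C * (ℚ.1/ C * ε) ≡ ε
    eq = trans (sym (ℚₚ.*-assoc C (ℚ.1/ C) ε))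
        (trans (cong (_* ε) (ℚₚ.*-inverseʳ C)) (ℚₚ.*-identityˡ ε))

  *-mono-nonNeg : ∀ {p q r s} → 0ℚ ≤ r → 0ℚ ≤ q → p ≤ q → r ≤ s → p * r ≤ q * s
  *-mono-nonNeg {p} {q} {r} {s} 0≤r 0≤q p≤q r≤s = ℚₚ.≤-trans
    (ℚₚ.*-monoʳ-≤-nonNeg r {{ℚ.nonNegative 0≤r}} p≤q)
    (ℚₚ.*-monoˡ-≤-nonNeg q {{ℚ.nonNegative 0≤q}} r≤s)

  ∣-∣-swap : ∀ p q → ∣ p - q ∣ℚ ≡ ∣ q - p ∣ℚ
  ∣-∣-swap p q = trans (sym (ℚₚ.∣-p∣≡∣p∣ (p - q)))
    (cong ∣_∣ℚ (solve 2 (λ p q → :- (p :- q) := q :- p) refl p q))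
    where open +-*-Solver

  ∣p∣≤∣q∣+∣p-q∣ : ∀ p q → ∣ p ∣ℚ ≤ ∣ q ∣ℚ + ∣ p - q ∣ℚ
  ∣p∣≤∣q∣+∣p-q∣ p q = subst (λ z → ∣ z ∣ℚ ≤ ∣ q ∣ℚ + ∣ p - q ∣ℚ)
    (solve 2 (λ p q → q :+ (p :- q) := p) refl p q)
    (ℚₚ.∣p+q∣≤∣p∣+∣q∣ q (p - q))
    where open +-*-Solver

  p≤q+r⇒p-q≤r : ∀ {p} q {r} → p ≤ q + r → p - q ≤ r
  p≤q+r⇒p-q≤r {p} q {r} h = subst (p - q ≤_)
    (solve 2 (λ q r → q :+ r :- q := r) refl q r) (ℚₚ.+-monoˡ-≤ (- q) h)
    where open +-*-Solver

  ∣p∣≤ : ∀ {p r} → p ≤ r → - p ≤ r → ∣ p ∣ℚ ≤ r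
  ∣p∣≤ {p} p≤r -p≤r with ℚₚ.∣p∣≡p∨∣p∣≡-p p
  ... | inj₁ eq = subst (_≤ _) (sym eq) p≤r
  ... | inj₂ eq = subst (_≤ _) (sym eq) -p≤r

  ∣∣p∣-∣q∣∣≤ : ∀ p q → ∣ ∣ p ∣ℚ - ∣ q ∣ℚ ∣ℚ ≤ ∣ p - q ∣ℚ
  ∣∣p∣-∣q∣∣≤ p q = ∣p∣≤
    (p≤q+r⇒p-q≤r ∣ q ∣ℚ (∣p∣≤∣q∣+∣p-q∣ p q))
    (subst (_≤ ∣ p - q ∣ℚ)
      (solve 2 (λ a b → b :- a := :- (a :- b)) refl ∣ p ∣ℚ ∣ q ∣ℚ)
      (p≤q+r⇒p-q≤r ∣ p ∣ℚ
        (subst (λ z → ∣ q ∣ℚ ≤ ∣ p ∣ℚ + z) (∣-∣-swap q p) (∣p∣≤∣q∣+∣p-q∣ q p))))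
    where open +-*-Solver

  bounded : ∀ x → ∃[ B ] 0ℚ < B × (∃[ N ] (∀ m → N ℕ.≤ m → ∣ seq x m ∣ℚ ≤ B))
  bounded x with cauchy x 1ℚ 0<1
  ... | N , p = ∣ seq x N ∣ℚ + 1ℚ
    , ℚₚ.+-mono-≤-< (ℚₚ.0≤∣p∣ (seq x N)) 0<1
    , N , λ m N≤m → ℚₚ.≤-trans (∣p∣≤∣q∣+∣p-q∣ (seq x m) (seq x N))
        (ℚₚ.+-monoʳ-≤ ∣ seq x N ∣ℚ (ℚₚ.<⇒≤ (p m N N≤m ℕₚ.≤-refl)))

  Close : (ℕ → ℚ) → ℚ → Set
  Close s ε = ∃[ N ] (∀ m n → N ℕ.≤ m → N ℕ.≤ n → ∣ s m - s n ∣ℚ < ε)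

  cauchy-- : ∀ x y → IsCauchy (λ n → seq x n - seq y n)
  cauchy-- x y = cauchy-scaled {λ n → seq x n - seq y n} (1ℚ + 1ℚ) (0<+ 0<1 0<1) bound
    where
    open +-*-Solver
    rearrange : ∀ a b c d → (a - b) - (c - d) ≡ (a - c) - (b - d)
    rearrange = solve 4 (λ a b c d → (a :- b) :- (c :- d) := (a :- c) :- (b :- d)) refl
    double : ∀ ε → ε + ε ≡ (1ℚ + 1ℚ) * ε
    double ε = sym (trans (ℚₚ.*-distribʳ-+ ε 1ℚ 1ℚ)
      (cong₂ _+_ (ℚₚ.*-identityˡ ε) (ℚₚ.*-identityˡ ε)))
    bound : ∀ ε → 0ℚ < ε → Close (λ n → seq x n - seq y n) ((1ℚ + 1ℚ) * ε)
    bound ε 0<ε with cauchy x ε 0<ε | cauchy y ε 0<ε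
    ... | M , p | N , q = M ℕ.⊔ N , λ m n h₁ h₂ →
      subst₂ (λ a b → ∣ a ∣ℚ < b)
        (rearrange (seq x m) (seq x n) (seq y m) (seq y n))
        (double ε)
        (ℚₚ.≤-<-trans (ℚₚ.∣p-q∣≤∣p∣+∣q∣ (seq x m - seq x n) (seq y m - seq y n))
          (ℚₚ.+-mono-<
            (p m n (ℕₚ.m⊔n≤o⇒m≤o M N h₁) (ℕₚ.m⊔n≤o⇒m≤o M N h₂))
            (q m n (ℕₚ.m⊔n≤o⇒n≤o M N h₁) (ℕₚ.m⊔n≤o⇒n≤o M N h₂))))

  cauchy-∣∣ : ∀ x → IsCauchy (λ n → ∣ seq x n ∣ℚ)
  cauchy-∣∣ x ε 0<ε with cauchy x ε 0<ε
  ... | N , p = N , λ m n h₁ h₂ →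
    ℚₚ.≤-<-trans (∣∣p∣-∣q∣∣≤ (seq x m) (seq x n)) (p m n h₁ h₂)

  split : ∀ a b c d → a * (c - d) + d * (a - b) ≡ a * c - b * d
  split = solve 4 (λ a b c d → a :* (c :- d) :+ d :* (a :- b) := a :* c :- b :* d) refl
    where open +-*-Solver

  ∣*∣< : ∀ p q C ε → 0ℚ < C → ∣ p ∣ℚ ≤ C → ∣ q ∣ℚ < ε → ∣ p * q ∣ℚ < C * ε
  ∣*∣< p q C ε 0<C p≤C q<ε = subst (_< C * ε) (sym (ℚₚ.∣p*q∣≡∣p∣*∣q∣ p q))
    (ℚₚ.≤-<-trans
      (*-mono-nonNeg (ℚₚ.0≤∣p∣ q) (ℚₚ.<⇒≤ 0<C) p≤C ℚₚ.≤-refl)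
      (ℚₚ.*-monoʳ-<-pos C {{0<⇒pos 0<C}} q<ε))

  product-estimate : ∀ A B → 0ℚ < A → 0ℚ < B → ∀ a b c d ε → ∣ a ∣ℚ ≤ A → ∣ d ∣ℚ ≤ B →
    ∣ c - d ∣ℚ < ε → ∣ a - b ∣ℚ < ε → ∣ a * c - b * d ∣ℚ < (A + B) * ε
  product-estimate A B 0<A 0<B a b c d ε a≤A d≤B cd<ε ab<ε = begin-strict
    ∣ a * c - b * d ∣ℚ                       ≡⟨ cong ∣_∣ℚ (sym (split a b c d)) ⟩
    ∣ a * (c - d) + d * (a - b) ∣ℚ           ≤⟨ ℚₚ.∣p+q∣≤∣p∣+∣q∣ (a * (c - d)) (d * (a - b)) ⟩
    ∣ a * (c - d) ∣ℚ + ∣ d * (a - b) ∣ℚ      <⟨ ℚₚ.+-mono-<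
                                                  (∣*∣< a (c - d) A ε 0<A a≤A cd<ε)
                                                  (∣*∣< d (a - b) B ε 0<B d≤B ab<ε) ⟩
    A * ε + B * ε                            ≡⟨ sym (ℚₚ.*-distribʳ-+ ε A B) ⟩
    (A + B) * ε                              ∎
    where open ℚₚ.≤-Reasoning

  cauchy-* : ∀ x y → IsCauchy (λ n → seq x n * seq y n)
  cauchy-* x y = cauchy-scaled {λ n → seq x n * seq y n} (A + B) (0<+ {A} {B} 0<A 0<B) bound
    where
    A = proj₁ (bounded x)
    B = proj₁ (bounded y)
    0<A = proj₁ (proj₂ (bounded x))
    0<B = proj₁ (proj₂ (bounded y))
    K = proj₁ (proj₂ (proj₂ (bounded x)))
    L = proj₁ (proj₂ (proj₂ (bounded y)))
    bx = proj₂ (proj₂ (proj₂ (bounded x)))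
    by = proj₂ (proj₂ (proj₂ (bounded y)))
    bound : ∀ ε → 0ℚ < ε → Close (λ n → seq x n * seq y n) ((A + B) * ε)
    bound ε 0<ε with cauchy x ε 0<ε | cauchy y ε 0<ε
    ... | M , p | N , q = (K ℕ.⊔ L) ℕ.⊔ (M ℕ.⊔ N) , λ m n h₁ h₂ →
      let m₁ = ℕₚ.m⊔n≤o⇒m≤o (K ℕ.⊔ L) (M ℕ.⊔ N) h₁
          n₁ = ℕₚ.m⊔n≤o⇒m≤o (K ℕ.⊔ L) (M ℕ.⊔ N) h₂
          m₂ = ℕₚ.m⊔n≤o⇒n≤o (K ℕ.⊔ L) (M ℕ.⊔ N) h₁
          n₂ = ℕₚ.m⊔n≤o⇒n≤o (K ℕ.⊔ L) (M ℕ.⊔ N) h₂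
      in product-estimate A B 0<A 0<B (seq x m) (seq x n) (seq y m) (seq y n) ε
        (bx m (ℕₚ.m⊔n≤o⇒m≤o K L m₁))
        (by n (ℕₚ.m⊔n≤o⇒n≤o K L n₁))
        (q m n (ℕₚ.m⊔n≤o⇒n≤o M N m₂) (ℕₚ.m⊔n≤o⇒n≤o M N n₂))
        (p m n (ℕₚ.m⊔n≤o⇒m≤o M N m₂) (ℕₚ.m⊔n≤o⇒m≤o M N n₂))

open RationalLemmas

fromℚ : ℚ → ℝ
fromℚ q = mkℝ (λ _ → q) λ ε 0<ε → 0 , λ _ _ _ _ →
  subst (_< ε) (sym (cong ∣_∣ℚ (ℚₚ.+-inverseʳ q))) 0<ε

infixl 6 _-ℝ_
infixl 7 _*ℝ_
infixr 8 _^ℝ_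
infix  4 _<ℝ_ _⟶_

_-ℝ_ : ℝ → ℝ → ℝ
x -ℝ y = mkℝ (λ n → seq x n - seq y n) (cauchy-- x y)

∣_∣ℝ : ℝ → ℝ
∣ x ∣ℝ = mkℝ (λ n → ∣ seq x n ∣ℚ) (cauchy-∣∣ x)

_*ℝ_ : ℝ → ℝ → ℝ
x *ℝ y = mkℝ (λ n → seq x n * seq y n) (cauchy-* x y)

0ℝ 1ℝ : ℝ
0ℝ = fromℚ 0ℚ
1ℝ = fromℚ 1ℚ

_^ℝ_ : ℝ → ℕ → ℝ
x ^ℝ zero  = 1ℝ
x ^ℝ suc n = x *ℝ (x ^ℝ n)

-- The gap δ makes this the strict order of the represented reals: a
-- termwise eventual `<` would also hold between equal reals.
_<ℝ_ : ℝ → ℝ → Set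
x <ℝ y = ∃[ δ ] 0ℚ < δ × (∃[ N ] (∀ n → N ℕ.≤ n → seq x n + δ ≤ seq y n))

-- Total reciprocal on ℚ; under the hypothesis of `invℝ` below, the value
-- at 0 affects only finitely many terms.
recip : ℚ → ℚ
recip q with q ℚₚ.≟ 0ℚ
... | yes _  = 0ℚ
... | no q≢0 = (ℚ.1/ q) {{ℚ.≢-nonZero q≢0}}

module ReciprocalLemmas where
  recip-inverse : ∀ q → q ≢ 0ℚ → recip q * q ≡ 1ℚ
  recip-inverse q q≢0 with q ℚₚ.≟ 0ℚ
  ... | yes q≡0 = contradiction q≡0 q≢0
  ... | no q≢0′ = ℚₚ.*-inverseˡ q {{ℚ.≢-nonZero q≢0′}}

  apart⇒≢0 : ∀ {δ a} → 0ℚ < δ → δ ≤ ∣ a ∣ℚ → a ≢ 0ℚ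
  apart⇒≢0 0<δ δ≤∣a∣ refl = ℚₚ.<-irrefl refl (ℚₚ.<-≤-trans 0<δ δ≤∣a∣)

  ∣recip∣≤ : ∀ δ (0<δ : 0ℚ < δ) a → δ ≤ ∣ a ∣ℚ → ∣ recip a ∣ℚ ≤ (ℚ.1/ δ) {{ℚ.>-nonZero 0<δ}}
  ∣recip∣≤ δ 0<δ a δ≤∣a∣ = begin
    ∣ r ∣ℚ                        ≡⟨ sym (ℚₚ.*-identityʳ ∣ r ∣ℚ) ⟩
    ∣ r ∣ℚ * 1ℚ                   ≡⟨ cong (∣ r ∣ℚ *_) (sym (ℚₚ.*-inverseʳ δ)) ⟩
    ∣ r ∣ℚ * (δ * ℚ.1/ δ)         ≤⟨ ℚₚ.*-monoˡ-≤-nonNeg ∣ r ∣ℚ {{ℚₚ.∣-∣-nonNeg r}}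
                                     (ℚₚ.*-monoʳ-≤-nonNeg (ℚ.1/ δ)
                                       {{ℚ.nonNegative (ℚₚ.<⇒≤ (0<1/ 0<δ))}} δ≤∣a∣) ⟩
    ∣ r ∣ℚ * (∣ a ∣ℚ * ℚ.1/ δ)    ≡⟨ sym (ℚₚ.*-assoc ∣ r ∣ℚ ∣ a ∣ℚ (ℚ.1/ δ)) ⟩
    (∣ r ∣ℚ * ∣ a ∣ℚ) * ℚ.1/ δ    ≡⟨ cong (_* ℚ.1/ δ) (sym (ℚₚ.∣p*q∣≡∣p∣*∣q∣ r a)) ⟩
    ∣ r * a ∣ℚ * ℚ.1/ δ           ≡⟨ cong (λ z → ∣ z ∣ℚ * ℚ.1/ δ)
                                     (recip-inverse a (apart⇒≢0 0<δ δ≤∣a∣)) ⟩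
    1ℚ * ℚ.1/ δ                   ≡⟨ ℚₚ.*-identityˡ (ℚ.1/ δ) ⟩
    ℚ.1/ δ                        ∎
    where
    open ℚₚ.≤-Reasoning
    instance _ = ℚ.>-nonZero 0<δ
    r = recip a

  recip-difference : ∀ a b → a ≢ 0ℚ → b ≢ 0ℚ →
    recip a - recip b ≡ (recip a * recip b) * (b - a)
  recip-difference a b a≢0 b≢0 = sym (begin
    (r * s) * (b - a)             ≡⟨ rearrange r s a b ⟩
    r * (s * b) - s * (r * a)     ≡⟨ cong₂ (λ u v → r * u - s * v)
                                       (recip-inverse b b≢0) (recip-inverse a a≢0) ⟩
    r * 1ℚ - s * 1ℚ               ≡⟨ cong₂ _-_ (ℚₚ.*-identityʳ r) (ℚₚ.*-identityʳ s) ⟩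
    r - s                         ∎)
    where
    open ≡-Reasoning
    open +-*-Solver
    r = recip a
    s = recip b
    rearrange : ∀ r s a b → (r * s) * (b - a) ≡ r * (s * b) - s * (r * a)
    rearrange = solve 4 (λ r s a b → (r :* s) :* (b :- a) := r :* (s :* b) :- s :* (r :* a)) refl

  recip-estimate : ∀ δ (0<δ : 0ℚ < δ) a b ε → δ ≤ ∣ a ∣ℚ → δ ≤ ∣ b ∣ℚ → ∣ a - b ∣ℚ < ε →
    let D = (ℚ.1/ δ) {{ℚ.>-nonZero 0<δ}} in ∣ recip a - recip b ∣ℚ < (D * D) * ε
  recip-estimate δ 0<δ a b ε δ≤a δ≤b ab<ε = begin-strict
    ∣ recip a - recip b ∣ℚ                    ≡⟨ cong ∣_∣ℚ (recip-difference a b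
                                                   (apart⇒≢0 0<δ δ≤a) (apart⇒≢0 0<δ δ≤b)) ⟩
    ∣ (recip a * recip b) * (b - a) ∣ℚ        <⟨ ∣*∣< (recip a * recip b) (b - a) (D * D) ε
                                                   (0<* (0<1/ 0<δ) (0<1/ 0<δ)) rr≤ ba<ε ⟩
    (D * D) * ε                               ∎
    where
    open ℚₚ.≤-Reasoning
    D = (ℚ.1/ δ) {{ℚ.>-nonZero 0<δ}}
    ba<ε : ∣ b - a ∣ℚ < ε
    ba<ε = subst (_< ε) (∣-∣-swap a b) ab<ε
    rr≤ : ∣ recip a * recip b ∣ℚ ≤ D * D
    rr≤ = subst (_≤ D * D) (sym (ℚₚ.∣p*q∣≡∣p∣*∣q∣ (recip a) (recip b)))
      (*-mono-nonNeg (ℚₚ.0≤∣p∣ (recip b)) (ℚₚ.<⇒≤ (0<1/ 0<δ))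
        (∣recip∣≤ δ 0<δ a δ≤a) (∣recip∣≤ δ 0<δ b δ≤b))

  cauchy-recip : ∀ x → 0ℝ <ℝ ∣ x ∣ℝ → IsCauchy (λ n → recip (seq x n))
  cauchy-recip x (δ , 0<δ , K , h) =
    cauchy-scaled {λ n → recip (seq x n)} (D * D) (0<* (0<1/ 0<δ) (0<1/ 0<δ)) bound
    where
    D = (ℚ.1/ δ) {{ℚ.>-nonZero 0<δ}}
    δ≤ : ∀ n → K ℕ.≤ n → δ ≤ ∣ seq x n ∣ℚ
    δ≤ n K≤n = subst (_≤ ∣ seq x n ∣ℚ) (ℚₚ.+-identityˡ δ) (h n K≤n)
    bound : ∀ ε → 0ℚ < ε → Close (λ n → recip (seq x n)) ((D * D) * ε)
    bound ε 0<ε with cauchy x ε 0<ε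
    ... | N , p = K ℕ.⊔ N , λ m n h₁ h₂ →
      recip-estimate δ 0<δ (seq x m) (seq x n) ε
        (δ≤ m (ℕₚ.m⊔n≤o⇒m≤o K N h₁)) (δ≤ n (ℕₚ.m⊔n≤o⇒m≤o K N h₂))
        (p m n (ℕₚ.m⊔n≤o⇒n≤o K N h₁) (ℕₚ.m⊔n≤o⇒n≤o K N h₂))

open ReciprocalLemmas

invℝ : (x : ℝ) → 0ℝ <ℝ ∣ x ∣ℝ → ℝ
invℝ x x≠0 = mkℝ (λ n → recip (seq x n)) (cauchy-recip x x≠0)

_⟶_ : (ℕ → ℝ) → ℝ → Set
a ⟶ L = ∀ ε → 0ℝ <ℝ ε → ∃[ N ] (∀ n → N ℕ.≤ n → ∣ a n -ℝ L ∣ℝ <ℝ ε)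

-- The sum of 1/i! over i < m.
eSum : ℕ → ℚ
eSum zero    = 0ℚ
eSum (suc m) = eSum m + (+ 1 / (m !)) {{m ℕₚ.!≢0}}

module SeriesLemmas where
  u : ∀ m .{{_ : NonZero m}} → ℚ
  u m = + 1 / m

  0≤u : ∀ m .{{_ : NonZero m}} → 0ℚ ≤ u m
  0≤u m = ℚₚ.nonNegative⁻¹ (u m) {{ℚₚ.normalize-nonNeg 1 m}}

  toℚᵘ-u : ∀ m → ℚ.toℚᵘ (u (suc m)) ℚᵘ.≃ mkℚᵘ (+ 1) m
  toℚᵘ-u m = ℚₚ.toℚᵘ-fromℚᵘ (mkℚᵘ (+ 1) m)

  telescope-suc : ∀ m f → suc m ℕ.* suc (suc m) ℕ.≤ suc f →
    u (suc f) + u (suc (suc m)) ≤ u (suc m)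
  telescope-suc m f h = ℚₚ.toℚᵘ-cancel-≤ (begin
    ℚ.toℚᵘ (u (suc f) + u (suc (suc m)))
      ≃⟨ ℚₚ.toℚᵘ-homo-+ (u (suc f)) (u (suc (suc m))) ⟩
    ℚ.toℚᵘ (u (suc f)) ℚᵘ.+ ℚ.toℚᵘ (u (suc (suc m)))
      ≃⟨ ℚᵘₚ.+-cong (toℚᵘ-u f) (toℚᵘ-u (suc m)) ⟩
    mkℚᵘ (+ 1) f ℚᵘ.+ mkℚᵘ (+ 1) (suc m)
      ≤⟨ ℚᵘ.*≤* (subst₂ ℤ._≤_ (sym lhs) (sym (ℤₚ.*-identityˡ (+ (F ℕ.* suc (suc m))))) (ℤ.+≤+ nat)) ⟩
    mkℚᵘ (+ 1) m
      ≃⟨ ℚᵘₚ.≃-sym (toℚᵘ-u m) ⟩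
    ℚ.toℚᵘ (u (suc m)) ∎)
    where
    open ℚᵘₚ.≤-Reasoning
    F = suc f
    lhs : (+ 1 ℤ.* + suc (suc m) ℤ.+ + 1 ℤ.* + F) ℤ.* + suc m ≡ + ((suc (suc m) ℕ.+ F) ℕ.* suc m)
    lhs = trans (cong₂ (λ a b → (a ℤ.+ b) ℤ.* + suc m)
                  (ℤₚ.*-identityˡ (+ suc (suc m))) (ℤₚ.*-identityˡ (+ F)))
                (sym (ℤₚ.pos-* (suc (suc m) ℕ.+ F) (suc m)))
    nat : (suc (suc m) ℕ.+ F) ℕ.* suc m ℕ.≤ F ℕ.* suc (suc m)
    nat = subst₂ ℕ._≤_
      (sym (trans (ℕₚ.*-distribʳ-+ (suc m) (suc (suc m)) F)
                  (cong (ℕ._+ F ℕ.* suc m) (ℕₚ.*-comm (suc (suc m)) (suc m)))))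
      (sym (ℕₚ.*-suc F (suc m)))
      (ℕₚ.+-monoˡ-≤ (F ℕ.* suc m) h)

  telescope : ∀ m F .{{_ : NonZero F}} → suc m ℕ.* suc (suc m) ℕ.≤ F →
    u F + u (suc (suc m)) ≤ u (suc m)
  telescope m (suc f) = telescope-suc m f

  factorial-bound : ∀ m → suc m ℕ.* suc (suc m) ℕ.≤ suc (suc m) !
  factorial-bound m = subst (ℕ._≤ suc (suc m) !) (ℕₚ.*-comm (suc (suc m)) (suc m))
    (ℕₚ.*-monoʳ-≤ (suc (suc m))
      (ℕₚ.m≤m*n (suc m) (m !) {{m ℕₚ.!≢0}}))

  eSum-step : ∀ m → eSum m ≤ eSum (suc m)
  eSum-step m = subst (_≤ eSum (suc m)) (ℚₚ.+-identityʳ (eSum m))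
    (ℚₚ.+-monoʳ-≤ (eSum m) (0≤u (m !) {{m ℕₚ.!≢0}}))

  eSum-mono : ∀ m d → eSum m ≤ eSum (d ℕ.+ m)
  eSum-mono m zero    = ℚₚ.≤-refl
  eSum-mono m (suc d) = ℚₚ.≤-trans (eSum-mono m d) (eSum-step (d ℕ.+ m))

  upper : ℕ → ℚ
  upper m = eSum (suc (suc m)) + u (suc m)

  upper-step : ∀ m → upper (suc m) ≤ upper m
  upper-step m = subst (_≤ upper m)
    (sym (ℚₚ.+-assoc (eSum (suc (suc m))) (u (suc (suc m) !) {{suc (suc m) ℕₚ.!≢0}}) (u (suc (suc m)))))
    (ℚₚ.+-monoʳ-≤ (eSum (suc (suc m)))
      (telescope m (suc (suc m) !) {{suc (suc m) ℕₚ.!≢0}} (factorial-bound m)))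

  upper-anti : ∀ m d → upper (d ℕ.+ m) ≤ upper m
  upper-anti m zero    = ℚₚ.≤-refl
  upper-anti m (suc d) = ℚₚ.≤-trans (upper-step (d ℕ.+ m)) (upper-anti m d)

  eSum≤upper : ∀ m → eSum (suc (suc m)) ≤ upper m
  eSum≤upper m = subst (_≤ upper m) (ℚₚ.+-identityʳ (eSum (suc (suc m))))
    (ℚₚ.+-monoʳ-≤ (eSum (suc (suc m))) (0≤u (suc m)))

  eSum-lower : ∀ N n → suc (suc N) ℕ.≤ n → eSum (suc (suc N)) ≤ eSum n
  eSum-lower N n h = subst (λ j → eSum (suc (suc N)) ≤ eSum j) (ℕₚ.m∸n+n≡m h)
    (eSum-mono (suc (suc N)) (n ℕ.∸ suc (suc N)))

  eSum-upper : ∀ N n → suc (suc N) ℕ.≤ n → eSum n ≤ upper N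
  eSum-upper N (suc (suc n)) (s≤s (s≤s h)) = ℚₚ.≤-trans (eSum≤upper n)
    (subst (λ j → upper j ≤ upper N) (ℕₚ.m∸n+n≡m h) (upper-anti N (n ℕ.∸ N)))

  archimedean : ∀ ε → 0ℚ < ε → ∃[ N ] u (suc N) < ε
  archimedean ε@(mkℚ (+ suc p) d _) _ = suc d , ℚₚ.toℚᵘ-cancel-<
    (ℚᵘₚ.<-respˡ-≃ (ℚᵘₚ.≃-sym (toℚᵘ-u (suc d)))
      (ℚᵘ.*<* (subst₂ ℤ._<_ (sym (ℤₚ.*-identityˡ (+ suc d))) (ℤₚ.pos-* (suc p) (suc (suc d)))
        (ℤ.+<+ (ℕₚ.m≤m+n (suc (suc d)) (p ℕ.* suc (suc d)))))))
  archimedean (mkℚ (+ zero) d _) (ℚ.*<* 0<ε) =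
    contradiction 0<ε (ℤₚ.<-irrefl refl)
  archimedean (mkℚ (ℤ.-[1+ p ]) d _) (ℚ.*<* ())

  within : ∀ {a x y r} → a ≤ y → x ≤ a + r → x - y ≤ r
  within {a} {x} {y} {r} a≤y x≤a+r = p≤q+r⇒p-q≤r y
    (ℚₚ.≤-trans x≤a+r (ℚₚ.+-monoˡ-≤ r a≤y))

  cauchy-eSum : IsCauchy eSum
  cauchy-eSum ε 0<ε with archimedean ε 0<ε
  ... | N , u<ε = suc (suc N) , λ m n h₁ h₂ → ℚₚ.≤-<-trans
    (∣p∣≤ {eSum m - eSum n} {u (suc N)}
      (within {eSum (suc (suc N))} (eSum-lower N n h₂) (eSum-upper N m h₁))
      (subst (_≤ u (suc N)) (swap (eSum m) (eSum n))
        (within {eSum (suc (suc N))} (eSum-lower N m h₁) (eSum-upper N n h₂))))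
    u<ε
    where
    open +-*-Solver
    swap : ∀ p q → q - p ≡ - (p - q)
    swap = solve 2 (λ p q → q :- p := :- (p :- q)) refl

open SeriesLemmas

e : ℝ
e = mkℝ eSum cauchy-eSum

module PowerLemmas where
  1≤e^k : ∀ k n → 1 ℕ.≤ n → 1ℚ ≤ seq (e ^ℝ k) n
  1≤e^k zero    n _ = ℚₚ.≤-refl
  1≤e^k (suc k) n@(suc n-1) h = subst (_≤ eSum n * seq (e ^ℝ k) n) (ℚₚ.*-identityˡ 1ℚ)
    (*-mono-nonNeg (ℚₚ.<⇒≤ 0<1) (ℚₚ.≤-trans (ℚₚ.<⇒≤ 0<1) 1≤e) 1≤e (1≤e^k k n h))
    where
    1≤e : 1ℚ ≤ eSum n
    1≤e = subst (λ j → 1ℚ ≤ eSum j) (ℕₚ.+-comm n-1 1) (eSum-mono 1 n-1)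

open PowerLemmas

e^k≠0 : ∀ k → 0ℝ <ℝ ∣ e ^ℝ k ∣ℝ
e^k≠0 k = 1ℚ , 0<1 , 1 , λ n h →
  ℚₚ.≤-trans (1≤e^k k n h) (p≤∣p∣ (seq (e ^ℝ k) n) (ℚₚ.≤-trans (ℚₚ.<⇒≤ 0<1) (1≤e^k k n h)))
  where
  p≤∣p∣ : ∀ p → 0ℚ ≤ p → p ≤ ∣ p ∣ℚ
  p≤∣p∣ p 0≤p = ℚₚ.≤-reflexive (sym (ℚₚ.0≤p⇒∣p∣≡p 0≤p))

{-# OPTIONS --safe #-}
-- A space x is safe exactly when the pieces avoid the 1 + k(N - 1) spaces that
-- equal x or attack it, N being the side length.  Hence, with M = N^k and
-- m = N^(k-1), the expected proportion is C(M - c, m) / C(M, m) for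
-- c = 1 + k(N - 1), a product of c factors (M - m - i) / (M - i), i < c.  Each
-- factor is at most r = 1 - 1/N, and at least r (1 - O(1/N²)) because k ≥ 2; by
-- Bernoulli's inequality the product is r^c (1 - O(1/N)).  Finally
-- r^(N-1) = (1 + 1/(N-1))^-(N-1) and (1 + 1/n)^n ≤ e ≤ (1 + 1/n)^(n+1), where
-- both bounds hold for all sufficiently long partial sums of the series of e.
module Submission where

open import Defs

-- A real is a sequence of rationals here, and the j-th term of the limit is the reciprocal of the
-- k-th power of `eSum j`. So everything is estimated at a fixed cutoff j > n, with an error that
-- must not depend on j, and e is never handled as a real. The proportion is multiplied by that
-- power and the product is compared with 1; the division waits until the end, where it is harmless
-- because the divisor is at least 1. The side length is N = n + 1 throughout, which turns r into n
-- / N and 1 / r into 1 + 1/n. The condition k ≥ 2 gives m ≥ N, so that the c spaces to be avoided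
-- are few among the M spaces. For k = 1 they are the whole board, a single piece leaves nothing
-- safe, and the proportion is 0. The bounds for e come from walking from 0 to 1 along a Taylor
-- polynomial of exp, in n steps of length 1/n for the lower bound on e and in N steps of length 1/N
-- for the upper one, and comparing each increment with the derivative.

module Counting where
  open import Data.Bool.Base using (Bool; true; false)
  open import Data.Fin.Base using (Fin; zero; suc; _↑ˡ_; _↑ʳ_; combine)
  open import Data.Fin.Properties using (remQuot-combine; combine-surjective; combine-injectiveʳ) renaming (_≟_ to _≟ᶠ_)
  open import Data.Fin.Subset using (Subset; inside; outside; _∈_; _∉_; _⊆_; ∣_∣; ∁; ⊤)
  open import Data.Fin.Subset.Properties using (∣∁p∣≡n∸∣p∣; ∣⊤∣≡n; ⊆⊤; x∉p⇒x∈∁p; x∈∁p⇒x∉p)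
  open import Data.List.Base using (List; []; _∷_; _++_; map; filter; length; allFin)
  open import Data.Nat.ListAction using (sum)
  open import Data.List.Properties using (filter-++; length-++; filter-none; length-tabulate)
  open import Data.List.Relation.Unary.All using ([]; _∷_; universal)
  open import Data.Nat.Base
  open import Data.Nat.Combinatorics using (_C_; nCk+nC[k+1]≡[n+1]C[k+1])
  open import Data.Nat.Properties
  open import Algebra.Properties.CommutativeSemigroup +-commutativeSemigroup using (x∙yz≈y∙xz)
  open import Data.Product.Base using (_×_; _,_; proj₁; proj₂)
  open import Data.Sum.Base using (_⊎_; inj₁; inj₂)
  open import Data.Vec.Base using (tabulate; here; there)
  import Data.Vec.Base as Vec
  open import Level using (0ℓ)
  open import Data.Vec.Properties using (tabulate-cong; lookup∘tabulate; []=⇒lookup; lookup⇒[]=)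
  open import Function.Base using (_∘_)
  open import Function.Bundles using (_⇔_; mk⇔)
  open import Relation.Binary.PropositionalEquality
  open import Relation.Nullary.Decidable using (Dec; yes; no; does; does-⇔; dec-true; _⊎-dec_; _×-dec_)
  open import Relation.Nullary.Negation using (¬_; contradiction)
  open import Relation.Unary using (Pred; Decidable)

  -- Spaces that equal or attack a given space

  card : ∀ {n} → (Fin n → Bool) → ℕ
  card f = ∣ tabulate f ∣

  card-cong : ∀ {n} {f g : Fin n → Bool} → (∀ i → f i ≡ g i) → card f ≡ card g
  card-cong f≗g = cong ∣_∣ (tabulate-cong f≗g)

  card-↑ : ∀ a {b} (f : Fin (a + b) → Bool) →
    card f ≡ card (λ i → f (i ↑ˡ b)) + card (λ j → f (a ↑ʳ j))
  card-↑ zero    f = refl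
  card-↑ (suc a) f with f zero
  ... | true  = cong suc (card-↑ a (f ∘ suc))
  ... | false = card-↑ a (f ∘ suc)

  card-rows : ∀ a {b B} (f : Fin (a * b) → Bool) →
    (∀ (i : Fin a) → card {b} (λ j → f (combine i j)) ≡ B) → card f ≡ a * B
  card-rows zero    f rows = refl
  card-rows (suc a) {b} f rows = trans (card-↑ b f)
    (cong₂ _+_ (rows zero) (card-rows a (λ i → f (b ↑ʳ i)) (rows ∘ suc)))

  card-rows-except : ∀ {a b A B} (f : Fin (suc a * b) → Bool) (x : Fin (suc a)) →
    card {b} (λ j → f (combine x j)) ≡ A →
    (∀ i → i ≢ x → card {b} (λ j → f (combine i j)) ≡ B) →
    card f ≡ A + a * B
  card-rows-except {a} {b} f zero row rows = trans (card-↑ b f)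
    (cong₂ _+_ row (card-rows a (λ i → f (b ↑ʳ i)) (λ i → rows (suc i) λ ())))
  card-rows-except {suc a} {b} {A} {B} f (suc x) row rows = begin
    card f                                 ≡⟨ card-↑ b f ⟩
    card {b} (λ i → f (i ↑ˡ (suc a * b))) + card f′ ≡⟨ cong₂ _+_ (rows zero λ ())
                                               (card-rows-except {a} f′ x row
                                                 (λ i i≢x → rows (suc i) λ { refl → i≢x refl })) ⟩
    B + (A + a * B)                        ≡⟨ +-comm B _ ⟩
    A + a * B + B                          ≡⟨ +-assoc A _ B ⟩
    A + (a * B + B)                        ≡⟨ cong (A +_) (+-comm _ B) ⟩
    A + suc a * B                          ∎
    where
    open ≡-Reasoning
    f′ : Fin (suc a * b) → Bool
    f′ i = f (b ↑ʳ i)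

  card-≡ : ∀ {n} (x : Fin n) → card (λ y → does (y ≟ᶠ x)) ≡ 1
  card-≡ {suc n} zero    = cong suc (none n)
    where
    none : ∀ n → card {n} (λ _ → false) ≡ 0
    none zero    = refl
    none (suc n) = none n
  card-≡ {suc n} (suc x) = card-≡ x

  -- Occupation and attack are merged into one relation because it obeys a clean recursion on the
  -- dimension: in a parallel row the one attacking space sits at the position where equality would
  -- hold one dimension lower.
  Near : ∀ k n → Space k n → Space k n → Set
  Near k n x y = y ≡ x ⊎ Attacks {k} {n} y x

  near? : ∀ k n x y → Dec (Near k n x y)
  near? k n x y = (y ≟ᶠ x) ⊎-dec attacks? {k} {n} y x

  coord-injective : ∀ k {n} {x y : Space k n} →
    (∀ i → coord {k} {n} y i ≡ coord {k} {n} x i) → y ≡ x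
  coord-injective zero    {x = zero} {zero} _ = refl
  coord-injective (suc k) {n} {x} {y} h with combine-surjective {n} {n ^ k} x | combine-surjective {n} {n ^ k} y
  ... | x₀ , x′ , refl | y₀ , y′ , refl = cong₂ combine
    (trans (sym (cong proj₁ (remQuot-combine y₀ y′)))
      (trans (h zero) (cong proj₁ (remQuot-combine x₀ x′))))
    (coord-injective k λ i →
      trans (sym (cong (λ z → coord {k} {n} (proj₂ z) i) (remQuot-combine y₀ y′)))
        (trans (h (suc i)) (cong (λ z → coord {k} {n} (proj₂ z) i) (remQuot-combine x₀ x′))))

  module _ {k n : ℕ} where
    coord₀ : ∀ (x : Fin n) (x′ : Space k n) →
      coord {suc k} {n} (combine x x′) zero ≡ x
    coord₀ x x′ = cong proj₁ (remQuot-combine x x′)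

    coordₛ : ∀ (x : Fin n) (x′ : Space k n) i →
      coord {suc k} {n} (combine x x′) (suc i) ≡ coord {k} {n} x′ i
    coordₛ x x′ i = cong (λ z → coord {k} {n} (proj₂ z) i) (remQuot-combine x x′)

    -- The first coordinates agree, so a difference can only occur in a later coordinate, and
    -- deleting the first one changes nothing.
    near-same-row : ∀ x x′ y′ →
      Near (suc k) n (combine x x′) (combine x y′) ⇔ Near k n x′ y′
    near-same-row x x′ y′ = mk⇔ to from
      where
      to : Near (suc k) n (combine x x′) (combine x y′) → Near k n x′ y′
      to (inj₁ eq) = inj₁ (combine-injectiveʳ x y′ x x′ eq)
      to (inj₂ (zero , ≢x , _)) =
        contradiction (trans (coord₀ x y′) (sym (coord₀ x x′))) ≢x
      to (inj₂ (suc i , ≢x , eq)) = inj₂ (i ,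
        (λ e → ≢x (trans (coordₛ x y′ i) (trans e (sym (coordₛ x x′ i))))) ,
        λ j j≢i → trans (sym (coordₛ x y′ j))
          (trans (eq (suc j) λ { refl → j≢i refl }) (coordₛ x x′ j)))
      from : Near k n x′ y′ → Near (suc k) n (combine x x′) (combine x y′)
      from (inj₁ refl) = inj₁ refl
      from (inj₂ (i , ≢x , eq)) = inj₂ (suc i ,
        (λ e → ≢x (trans (sym (coordₛ x y′ i)) (trans e (coordₛ x x′ i)))) ,
        λ { zero _ → trans (coord₀ x y′) (sym (coord₀ x x′))
          ; (suc j) j≢i → trans (coordₛ x y′ j)
              (trans (eq j λ { refl → j≢i refl }) (sym (coordₛ x x′ j))) })

    -- The differing first coordinate already uses up the single coordinate in which an attacker may
    -- differ, so all others must agree.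
    near-other-row : ∀ x x′ y y′ → y ≢ x →
      Near (suc k) n (combine x x′) (combine y y′) ⇔ y′ ≡ x′
    near-other-row x x′ y y′ y≢x = mk⇔ to from
      where
      to : Near (suc k) n (combine x x′) (combine y y′) → y′ ≡ x′
      to (inj₁ eq) = combine-injectiveʳ y y′ x x′ eq
      to (inj₂ (zero , _ , eq)) = coord-injective k λ j →
        trans (sym (coordₛ y y′ j)) (trans (eq (suc j) λ ()) (coordₛ x x′ j))
      to (inj₂ (suc i , _ , eq)) =
        contradiction (trans (sym (coord₀ y y′)) (trans (eq zero λ ()) (coord₀ x x′))) y≢x
      from : y′ ≡ x′ → Near (suc k) n (combine x x′) (combine y y′)
      from refl = inj₂ (zero ,
        (λ e → y≢x (trans (sym (coord₀ y y′)) (trans e (coord₀ x x′)))) ,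
        λ { zero 0≢0 → contradiction refl 0≢0
          ; (suc j) _ → trans (coordₛ y y′ j) (sym (coordₛ x x′ j)) })

  -- Induction on the dimension, slicing by the first coordinate: the slice through x contributes
  -- the count for dimension k, and each of the n other slices contributes one space.
  card-near : ∀ k n (x : Space k (suc n)) → card (does ∘ near? k (suc n) x) ≡ suc (k * n)
  card-near zero    n zero = refl
  card-near (suc k) n x with combine-surjective {suc n} {suc n ^ k} x
  ... | x₀ , x′ , refl = begin
    card (does ∘ near? (suc k) (suc n) (combine x₀ x′))
      ≡⟨ card-rows-except {n} {suc n ^ k} (does ∘ near? (suc k) (suc n) (combine x₀ x′)) x₀
           (trans (card-cong λ y′ → does-⇔ (near-same-row {k} x₀ x′ y′) (near? (suc k) (suc n) _ _) (near? k (suc n) _ _))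
                  (card-near k n x′))
           (λ y y≢x → trans (card-cong λ y′ → does-⇔ (near-other-row {k} x₀ x′ y y′ y≢x) (near? (suc k) (suc n) _ _) (y′ ≟ᶠ x′))
                            (card-≡ x′)) ⟩
    suc (k * n) + n * 1  ≡⟨ cong (suc (k * n) +_) (*-identityʳ n) ⟩
    suc (k * n + n)      ≡⟨ cong suc (+-comm (k * n) n) ⟩
    suc (suc k * n)      ∎
    where open ≡-Reasoning

  -- Counting configurations and the pairs of a configuration and a safe space

  count : ∀ {A : Set} {P : Pred A 0ℓ} → Decidable P → List A → ℕ
  count P? xs = length (filter P? xs)

  module _ {A : Set} {P : Pred A 0ℓ} {Q : Pred A 0ℓ} (P? : Decidable P) (Q? : Decidable Q) where
    count-filter : ∀ xs → count P? (filter Q? xs) ≡ count (λ x → Q? x ×-dec P? x) xs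
    count-filter [] = refl
    count-filter (x ∷ xs) with does (Q? x)
    ... | false = count-filter xs
    ... | true with does (P? x)
    ...   | false = count-filter xs
    ...   | true  = cong suc (count-filter xs)

  count-map : ∀ {A B : Set} {P : Pred B 0ℓ} (P? : Decidable P) (f : A → B) xs →
    count P? (map f xs) ≡ count (P? ∘ f) xs
  count-map P? f [] = refl
  count-map P? f (x ∷ xs) with does (P? (f x))
  ... | false = count-map P? f xs
  ... | true  = cong suc (count-map P? f xs)

  count-none : ∀ {A : Set} {P : Pred A 0ℓ} (P? : Decidable P) xs → (∀ x → ¬ P x) → count P? xs ≡ 0
  count-none P? xs ¬P = cong length (filter-none P? (universal ¬P xs))

  count-++ : ∀ {A : Set} {P : Pred A 0ℓ} (P? : Decidable P) xs ys →
    count P? (xs ++ ys) ≡ count P? xs + count P? ys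
  count-++ P? xs ys = trans (cong length (filter-++ P? xs ys)) (length-++ (filter P? xs))

  inside-∷-⊈ : ∀ {n} {p q : Subset n} → ¬ (inside Vec.∷ p ⊆ outside Vec.∷ q)
  inside-∷-⊈ p⊆q with p⊆q here
  ... | ()

  ∷-⊆⁺ : ∀ {n} {p q : Subset n} {s} → p ⊆ q → s Vec.∷ p ⊆ s Vec.∷ q
  ∷-⊆⁺ p⊆q here        = here
  ∷-⊆⁺ p⊆q (there x∈p) = there (p⊆q x∈p)

  outside-∷-⊆ : ∀ {n} {p q : Subset n} {s} → p ⊆ q → outside Vec.∷ p ⊆ s Vec.∷ q
  outside-∷-⊆ p⊆q (there x∈p) = there (p⊆q x∈p)

  ∷-⊆⁻ : ∀ {n} {p q : Subset n} {s t} → s Vec.∷ p ⊆ t Vec.∷ q → p ⊆ q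
  ∷-⊆⁻ p⊆q x∈p with p⊆q (there x∈p)
  ... | there x∈q = x∈q

  -- Pascal's rule: if the first element lies in G, the subsets with it and those without it give
  -- the two summands; if not, only the latter exist. Describing P by two implications lets one
  -- lemma serve both for all configurations, with G = `⊤`, and for those that leave a space safe.
  count-subsets : ∀ {n} (G : Subset n) m {P : Subset n → Set} (P? : Decidable P) →
    (∀ B → P B → ∣ B ∣ ≡ m × B ⊆ G) → (∀ B → ∣ B ∣ ≡ m → B ⊆ G → P B) →
    count P? (allSubsets n) ≡ ∣ G ∣ C m
  count-subsets Vec.[] m P? to from with P? Vec.[]
  count-subsets Vec.[] zero    P? to from | yes _ = refl
  count-subsets Vec.[] zero    P? to from | no ¬p = contradiction (from Vec.[] refl λ ()) ¬p
  count-subsets Vec.[] (suc m) P? to from | yes p = contradiction (proj₁ (to Vec.[] p)) λ ()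
  count-subsets Vec.[] (suc m) P? to from | no _  = refl
  count-subsets {suc n} (s Vec.∷ G) m {P} P? to from = trans
    (count-++ P? (map (inside Vec.∷_) (allSubsets n)) _)
    (trans (cong₂ _+_ (count-map P? (inside Vec.∷_) (allSubsets n))
                      (trans (count-map P? (outside Vec.∷_) (allSubsets n)) outsides))
           (insides s m to from))
    where
    outsides : count (P? ∘ (outside Vec.∷_)) (allSubsets n) ≡ ∣ G ∣ C m
    outsides = count-subsets G m (P? ∘ (outside Vec.∷_))
      (λ B p → proj₁ (to (outside Vec.∷ B) p) , ∷-⊆⁻ (proj₂ (to (outside Vec.∷ B) p)))
      (λ B eq B⊆G → from (outside Vec.∷ B) eq (outside-∷-⊆ B⊆G))
    insides : ∀ s m →
      (∀ B → P B → ∣ B ∣ ≡ m × B ⊆ s Vec.∷ G) → (∀ B → ∣ B ∣ ≡ m → B ⊆ s Vec.∷ G → P B) →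
      count (P? ∘ (inside Vec.∷_)) (allSubsets n) + ∣ G ∣ C m ≡ ∣ s Vec.∷ G ∣ C m
    insides outside m to from = cong (_+ ∣ G ∣ C m)
      (count-none (P? ∘ (inside Vec.∷_)) (allSubsets n)
        λ B p → inside-∷-⊈ (proj₂ (to (inside Vec.∷ B) p)))
    insides inside zero to from = cong (_+ 1)
      (count-none (P? ∘ (inside Vec.∷_)) (allSubsets n)
        λ B p → contradiction (proj₁ (to (inside Vec.∷ B) p)) λ ())
    insides inside (suc m) to from = trans
      (cong (_+ ∣ G ∣ C suc m) (count-subsets G m (P? ∘ (inside Vec.∷_))
        (λ B p → suc-injective (proj₁ (to (inside Vec.∷ B) p)) , ∷-⊆⁻ (proj₂ (to (inside Vec.∷ B) p)))
        (λ B eq B⊆G → from (inside Vec.∷ B) (cong suc eq) (∷-⊆⁺ B⊆G))))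
      (nCk+nC[k+1]≡[n+1]C[k+1] ∣ G ∣ m)

  length-configurations : ∀ k n → length (configurations k n) ≡ (n ^ k) C (n ^ (k ∸ 1))
  length-configurations k n = trans
    (count-subsets {n ^ k} ⊤ (n ^ (k ∸ 1)) (λ B → ∣ B ∣ ≟ n ^ (k ∸ 1)) (λ B eq → eq , ⊆⊤) (λ B eq _ → eq))
    (cong (_C (n ^ (k ∸ 1))) (∣⊤∣≡n (n ^ k)))

  ∈-tabulate⁺ : ∀ {n} {P : Pred (Fin n) 0ℓ} (P? : Decidable P) {x} → P x → x ∈ tabulate (does ∘ P?)
  ∈-tabulate⁺ P? {x} p = lookup⇒[]= x _ (trans (lookup∘tabulate (does ∘ P?) x) (dec-true (P? x) p))

  ∈-tabulate⁻ : ∀ {n} {P : Pred (Fin n) 0ℓ} (P? : Decidable P) {x} → x ∈ tabulate (does ∘ P?) → P x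
  ∈-tabulate⁻ P? {x} x∈ with trans (sym (lookup∘tabulate (does ∘ P?) x)) ([]=⇒lookup x∈)
  ... | eq with P? x
  ...   | yes p = p

  -- Safety of x means that B lies in the complement of the set S of near spaces. The value does not
  -- depend on x, as `double-count` requires.
  count-safe : ∀ k n (x : Space k (suc n)) →
    count (λ B → safe? k (suc n) B x) (configurations k (suc n)) ≡
    (suc n ^ k ∸ suc (k * n)) C (suc n ^ (k ∸ 1))
  count-safe k n x = trans (count-filter (λ B → safe? k (suc n) B x) _ (allSubsets (suc n ^ k)))
    (trans (count-subsets (∁ S) (suc n ^ (k ∸ 1)) _
        (λ { B (eq , x∉B , unattacked) → eq , λ {y} y∈B → x∉p⇒x∈∁p λ y∈S →
          disjoint B x∉B unattacked y y∈B (∈-tabulate⁻ (near? k (suc n) x) y∈S) })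
        (λ B eq B⊆∁S → eq ,
          (λ x∈B → x∈∁p⇒x∉p (B⊆∁S x∈B) (∈-tabulate⁺ (near? k (suc n) x) (inj₁ refl))) ,
          λ y y∈B a → x∈∁p⇒x∉p (B⊆∁S y∈B) (∈-tabulate⁺ (near? k (suc n) x) (inj₂ a))))
      (cong (_C (suc n ^ (k ∸ 1)))
        (trans (∣∁p∣≡n∸∣p∣ S) (cong (suc n ^ k ∸_) (card-near k n x)))))
    where
    S = tabulate (does ∘ near? k (suc n) x)
    disjoint : ∀ B → x ∉ B → (∀ y → y ∈ B → ¬ Attacks {k} {suc n} y x) →
      ∀ y → y ∈ B → ¬ Near k (suc n) x y
    disjoint B x∉B unattacked y y∈B (inj₁ refl) = x∉B y∈B
    disjoint B x∉B unattacked y y∈B (inj₂ a)    = unattacked y y∈B a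

  module _ {A B : Set} {R : A → B → Set} (R? : ∀ a b → Dec (R a b)) where
    -- Linearity of expectation in counting form: both sides count the related pairs, once grouped
    -- by x and once by y.
    double-count : ∀ xs ys {c} → (∀ y → count (λ x → R? x y) xs ≡ c) →
      sum (map (λ x → count (R? x) ys) xs) ≡ length ys * c
    double-count xs []       h = sum-0 xs
      where
      sum-0 : ∀ xs → sum (map (λ x → count (R? x) []) xs) ≡ 0
      sum-0 []       = refl
      sum-0 (x ∷ xs) = sum-0 xs
    double-count xs (y ∷ ys) h = trans (sum-∷ xs) (cong₂ _+_ (h y) (double-count xs ys h))
      where
      sum-∷ : ∀ xs → sum (map (λ x → count (R? x) (y ∷ ys)) xs) ≡
        count (λ x → R? x y) xs + sum (map (λ x → count (R? x) ys) xs)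
      sum-∷ [] = refl
      sum-∷ (x ∷ xs) with does (R? x y)
      ... | true  = cong suc (trans (cong (count (R? x) ys +_) (sum-∷ xs))
        (x∙yz≈y∙xz (count (R? x) ys) (count (λ x → R? x y) xs) _))
      ... | false = trans (cong (count (R? x) ys +_) (sum-∷ xs))
        (x∙yz≈y∙xz (count (R? x) ys) (count (λ x → R? x y) xs) _)

  sum-safeCount : ∀ k n → sum (map (safeCount k (suc n)) (configurations k (suc n))) ≡
    suc n ^ k * ((suc n ^ k ∸ suc (k * n)) C (suc n ^ (k ∸ 1)))
  sum-safeCount k n = trans
    (double-count (safe? k (suc n)) (configurations k (suc n)) (allFin (suc n ^ k)) (count-safe k n))
    (cong (_* ((suc n ^ k ∸ suc (k * n)) C (suc n ^ (k ∸ 1)))) (length-tabulate {n = suc n ^ k} (λ i → i)))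

-- From counts to the expected proportion as a rational

module RationalConversion where
  open SeriesLemmas using (u; toℚᵘ-u)
  open Counting using (length-configurations; sum-safeCount)
  import Data.Integer.Base as ℤ
  import Data.Integer.Properties as ℤₚ
  open import Data.List.Base using (List; []; _∷_; map; length)
  open import Data.Nat.ListAction using (sum)
  open import Data.Nat.Base as ℕ using (ℕ; suc; NonZero; z≤n; s≤s; _∸_)
  open import Data.Nat.Combinatorics using (_C_)
  import Data.Nat.Properties as ℕₚ
  open import Data.Rational.Base as ℚ using (ℚ; 0ℚ; 1ℚ; _/_; _+_; _*_; _≤_)
  import Data.Rational.Properties as ℚₚ
  open import Data.Rational.Solver using (module +-*-Solver)
  open import Data.Rational.Unnormalised.Base as ℚᵘ using (mkℚᵘ)
  import Data.Rational.Unnormalised.Properties as ℚᵘₚ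
  open import Function.Base using (_∘_)
  open import Relation.Binary.PropositionalEquality

  ι : ℕ → ℚ
  ι n = ℤ.+ n / 1

  toℚᵘ-ι : ∀ n → ℚ.toℚᵘ (ι n) ℚᵘ.≃ mkℚᵘ (ℤ.+ n) 0
  toℚᵘ-ι n = ℚₚ.toℚᵘ-fromℚᵘ (mkℚᵘ (ℤ.+ n) 0)

  ι-+ : ∀ m n → ι (m ℕ.+ n) ≡ ι m + ι n
  ι-+ m n = ℚₚ.toℚᵘ-injective (begin
    ℚ.toℚᵘ (ι (m ℕ.+ n))               ≈⟨ toℚᵘ-ι (m ℕ.+ n) ⟩
    mkℚᵘ (ℤ.+ (m ℕ.+ n)) 0               ≈⟨ ℚᵘ.*≡* (cong (ℤ._* ℤ.+ 1)
                                           (sym (cong₂ ℤ._+_ (ℤₚ.*-identityʳ (ℤ.+ m)) (ℤₚ.*-identityʳ (ℤ.+ n))))) ⟩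
    mkℚᵘ (ℤ.+ m) 0 ℚᵘ.+ mkℚᵘ (ℤ.+ n) 0     ≈⟨ ℚᵘₚ.+-cong (toℚᵘ-ι m) (toℚᵘ-ι n) ⟨
    ℚ.toℚᵘ (ι m) ℚᵘ.+ ℚ.toℚᵘ (ι n)     ≈⟨ ℚₚ.toℚᵘ-homo-+ (ι m) (ι n) ⟨
    ℚ.toℚᵘ (ι m + ι n)                 ∎)
    where open ℚᵘₚ.≃-Reasoning

  ι-* : ∀ m n → ι (m ℕ.* n) ≡ ι m * ι n
  ι-* m n = ℚₚ.toℚᵘ-injective (begin
    ℚ.toℚᵘ (ι (m ℕ.* n))               ≈⟨ toℚᵘ-ι (m ℕ.* n) ⟩
    mkℚᵘ (ℤ.+ (m ℕ.* n)) 0               ≈⟨ ℚᵘ.*≡* (cong (ℤ._* ℤ.+ 1) (ℤₚ.pos-* m n)) ⟩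
    mkℚᵘ (ℤ.+ m) 0 ℚᵘ.* mkℚᵘ (ℤ.+ n) 0     ≈⟨ ℚᵘₚ.*-cong (toℚᵘ-ι m) (toℚᵘ-ι n) ⟨
    ℚ.toℚᵘ (ι m) ℚᵘ.* ℚ.toℚᵘ (ι n)     ≈⟨ ℚₚ.toℚᵘ-homo-* (ι m) (ι n) ⟨
    ℚ.toℚᵘ (ι m * ι n)                 ∎)
    where open ℚᵘₚ.≃-Reasoning

  ι-mono-≤ : ∀ {m n} → m ℕ.≤ n → ι m ≤ ι n
  ι-mono-≤ {m} {n} m≤n = ℚₚ.toℚᵘ-cancel-≤ (begin
    ℚ.toℚᵘ (ι m)   ≃⟨ toℚᵘ-ι m ⟩
    mkℚᵘ (ℤ.+ m) 0   ≤⟨ ℚᵘ.*≤* (ℤₚ.*-monoʳ-≤-nonNeg (ℤ.+ 1) (ℤ.+≤+ m≤n)) ⟩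
    mkℚᵘ (ℤ.+ n) 0   ≃⟨ toℚᵘ-ι n ⟨
    ℚ.toℚᵘ (ι n)   ∎)
    where open ℚᵘₚ.≤-Reasoning

  0≤ι : ∀ n → 0ℚ ≤ ι n
  0≤ι n = ι-mono-≤ {0} {n} z≤n

  ι-positive : ∀ n .{{_ : NonZero n}} → ℚ.Positive (ι n)
  ι-positive (suc n) = ℚ.positive (ℚₚ.<-≤-trans RationalLemmas.0<1 (ι-mono-≤ {1} {suc n} (s≤s z≤n)))

  u*ι : ∀ n .{{_ : NonZero n}} → u n * ι n ≡ 1ℚ
  u*ι (suc n) = ℚₚ.toℚᵘ-injective (begin
    ℚ.toℚᵘ (u (suc n) * ι (suc n))                ≈⟨ ℚₚ.toℚᵘ-homo-* (u (suc n)) (ι (suc n)) ⟩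
    ℚ.toℚᵘ (u (suc n)) ℚᵘ.* ℚ.toℚᵘ (ι (suc n))    ≈⟨ ℚᵘₚ.*-cong (toℚᵘ-u n) (toℚᵘ-ι (suc n)) ⟩
    mkℚᵘ (ℤ.+ 1) n ℚᵘ.* mkℚᵘ (ℤ.+ suc n) 0            ≈⟨ ℚᵘₚ.*-inverseˡ (mkℚᵘ (ℤ.+ suc n) 0) ⟩
    ℚ.toℚᵘ 1ℚ                                     ∎)
    where open ℚᵘₚ.≃-Reasoning

  *-u-cancelʳ : ∀ q n .{{_ : NonZero n}} → q * u n * ι n ≡ q
  *-u-cancelʳ q n = trans (ℚₚ.*-assoc q (u n) (ι n)) (trans (cong (q *_) (u*ι n)) (ℚₚ.*-identityʳ q))

  sumℚ-ι : ∀ {A : Set} (f : A → ℕ) xs → sumℚ (map (ι ∘ f) xs) ≡ ι (sum (map f xs))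
  sumℚ-ι f []       = refl
  sumℚ-ι f (x ∷ xs) = trans (cong (ι (f x) +_) (sumℚ-ι f xs)) (sym (ι-+ (f x) _))

  -- The multiplied form also covers the empty list, where `expectation` has its default value and
  -- both sides are 0.
  expectation-mean : ∀ {A : Set} (xs : List A) f → expectation xs f * ι (length xs) ≡ sumℚ (map f xs)
  expectation-mean []         f = refl
  expectation-mean xs@(_ ∷ _) f = *-u-cancelʳ (sumℚ (map f xs)) (length xs)

  *-cancelʳ : ∀ r .{{_ : ℚ.Positive r}} {p q} → p * r ≡ q * r → p ≡ q
  *-cancelʳ r eq = ℚₚ.≤-antisym
    (ℚₚ.*-cancelʳ-≤-pos r (ℚₚ.≤-reflexive eq)) (ℚₚ.*-cancelʳ-≤-pos r (ℚₚ.≤-reflexive (sym eq)))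

  -- The quotient of binomials from the overview, cross-multiplied. The factor M that
  -- `sum-safeCount` produces cancels against the division by the number of spaces.
  expectedSafeProportion-ratio : ∀ k n →
    expectedSafeProportion k (suc n) * ι ((suc n ℕ.^ k) C (suc n ℕ.^ (k ∸ 1))) ≡
    ι ((suc n ℕ.^ k ∸ suc (k ℕ.* n)) C (suc n ℕ.^ (k ∸ 1)))
  expectedSafeProportion-ratio k n = *-cancelʳ (ι M) {{ι-positive M}} (begin
    p * ι X * ι M                        ≡⟨ swap p (ι X) (ι M) ⟩
    p * ι M * ι X                        ≡⟨ cong (_* ι X) (*-u-cancelʳ (expectedSafe k (suc n)) M) ⟩
    expectedSafe k (suc n) * ι X         ≡⟨ cong (λ l → expectedSafe k (suc n) * ι l) (length-configurations k (suc n)) ⟨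
    expectedSafe k (suc n) * ι (length (configurations k (suc n)))
                                         ≡⟨ expectation-mean (configurations k (suc n)) (ι ∘ safeCount k (suc n)) ⟩
    sumℚ (map (ι ∘ safeCount k (suc n)) (configurations k (suc n)))
                                         ≡⟨ sumℚ-ι (safeCount k (suc n)) (configurations k (suc n)) ⟩
    ι (sum (map (safeCount k (suc n)) (configurations k (suc n))))
                                         ≡⟨ cong ι (sum-safeCount k n) ⟩
    ι (M ℕ.* Y)                          ≡⟨ cong ι (ℕₚ.*-comm M Y) ⟩
    ι (Y ℕ.* M)                          ≡⟨ ι-* Y M ⟩
    ι Y * ι M                            ∎)
    where
    open ≡-Reasoning
    M = suc n ℕ.^ k
    m = suc n ℕ.^ (k ∸ 1)
    X = M C m
    Y = (M ∸ suc (k ℕ.* n)) C m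
    p = expectedSafeProportion k (suc n)
    instance _ = ℕₚ.m^n≢0 (suc n) k
    swap : ∀ p x m → p * x * m ≡ p * m * x
    swap = solve 3 (λ p x m → p :* x :* m := p :* m :* x) refl
      where open +-*-Solver

-- Ratios of consecutive binomial coefficients

module BinomialRatio where
  open import Data.Nat.Base
  open import Data.Nat.Combinatorics using (_C_; nCk≡n!/k![n-k]!; k>n⇒nCk≡0; k![n∸k]!∣n!)
  open import Data.Nat.DivMod using (m/n*n≡m)
  open import Data.Nat.Properties
  open import Data.Nat.Solver using (module +-*-Solver)
  open import Relation.Binary.PropositionalEquality

  choose*factorials : ∀ m d → ((m + d) C m) * (m ! * d !) ≡ (m + d) !
  choose*factorials m d = subst (λ j → ((m + d) C m) * (m ! * j !) ≡ (m + d) !) (m+n∸m≡n m d)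
    (trans (cong (_* (m ! * (m + d ∸ m) !)) (nCk≡n!/k![n-k]! (m≤m+n m d)))
           (m/n*n≡m (k![n∸k]!∣n! (m≤m+n m d))))
    where instance _ = m !* (m + d ∸ m) !≢0

  choose≢0 : ∀ {m n} → m ≤ n → NonZero (n C m)
  choose≢0 {m} {n} m≤n = subst (λ n → NonZero (n C m)) (m+[n∸m]≡n m≤n)
    (m*n≢0⇒m≢0 _ {{subst NonZero (sym (choose*factorials m (n ∸ m))) ((m + (n ∸ m)) !≢0)}})

  -- Comparison of the factorial formulas: lowering the upper index from a + 1 to a multiplies the
  -- coefficient by (a + 1 - m) / (a + 1), and d stands for the difference. For d = 0 the
  -- coefficient with upper index a vanishes.
  choose-pred : ∀ m d a → m + d ≡ suc a → (a C m) * suc a ≡ (suc a C m) * d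
  choose-pred m zero    a eq = trans
    (cong (_* suc a) (k>n⇒nCk≡0 (≤-reflexive (trans (sym eq) (+-identityʳ m)))))
    (sym (*-zeroʳ (suc a C m)))
  choose-pred m (suc d) a eq with refl ← suc-injective (trans (sym eq) (+-suc m d)) =
    *-cancelʳ-≡ _ _ (m ! * d !) {{m !* d !≢0}} (begin
      X * suc (m + d) * (m ! * d !)     ≡⟨ rearrange₁ X (suc (m + d)) (m ! * d !) ⟩
      suc (m + d) * (X * (m ! * d !))   ≡⟨ cong (suc (m + d) *_) (choose*factorials m d) ⟩
      (suc (m + d)) !                   ≡⟨ cong _! (+-suc m d) ⟨
      (m + suc d) !                     ≡⟨ choose*factorials m (suc d) ⟨
      ((m + suc d) C m) * (m ! * suc d !) ≡⟨ cong (λ a → (a C m) * (m ! * suc d !)) (+-suc m d) ⟩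
      Y * (m ! * (suc d * d !))         ≡⟨ rearrange₂ Y (m !) (suc d) (d !) ⟩
      Y * suc d * (m ! * d !)           ∎)
    where
    open ≡-Reasoning
    open +-*-Solver
    X = (m + d) C m
    Y = suc (m + d) C m
    rearrange₁ : ∀ x s f → x * s * f ≡ s * (x * f)
    rearrange₁ = solve 3 (λ x s f → x :* s :* f := s :* (x :* f)) refl
    rearrange₂ : ∀ y a s b → y * (a * (s * b)) ≡ y * s * (a * b)
    rearrange₂ = solve 4 (λ y a s b → y :* (a :* (s :* b)) := y :* s :* (a :* b)) refl

  module _ {n m i d a : ℕ} (m+d≡ : m + d ≡ suc a) (i+d≡ : i + d ≡ n * m) where
    private
      X = a C m
      Y = suc a C m
      -- With N = n + 1, division by N (m + d) gives n/N - d/(m + d) = i / (N (m + d)), the exact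
      -- amount by which a factor falls short of r. The upper bound drops this defect, the lower
      -- bound controls it through h.
      balance : (m + d) * n ≡ i + suc n * d
      balance = begin
        (m + d) * n      ≡⟨ solve 3 (λ m d n → (m :+ d) :* n := n :* m :+ n :* d) refl m d n ⟩
        n * m + n * d    ≡⟨ cong (_+ n * d) i+d≡ ⟨
        i + d + n * d    ≡⟨ +-assoc i d (n * d) ⟩
        i + suc n * d    ∎
        where
        open ≡-Reasoning
        open +-*-Solver

    choose-pred-≤ : X * suc n ≤ Y * n
    choose-pred-≤ = *-cancelʳ-≤ _ _ (suc a) (begin
      X * suc n * suc a      ≡⟨ swapʳ X (suc n) (suc a) ⟩
      X * suc a * suc n      ≡⟨ cong (_* suc n) (choose-pred m d a m+d≡) ⟩
      Y * d * suc n          ≡⟨ *-assoc Y d (suc n) ⟩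
      Y * (d * suc n)        ≤⟨ *-monoʳ-≤ Y (begin
        d * suc n              ≡⟨ *-comm d (suc n) ⟩
        suc n * d              ≤⟨ m≤n+m (suc n * d) i ⟩
        i + suc n * d          ≡⟨ balance ⟨
        (m + d) * n            ≡⟨ cong (_* n) m+d≡ ⟩
        suc a * n              ≡⟨ *-comm (suc a) n ⟩
        n * suc a              ∎) ⟩
      Y * (n * suc a)        ≡⟨ *-assoc Y n (suc a) ⟨
      Y * n * suc a          ∎)
      where
      open ≤-Reasoning
      swapʳ : ∀ x y z → x * y * z ≡ x * z * y
      swapʳ = solve 3 (λ x y z → x :* y :* z := x :* z :* y) refl
        where open +-*-Solver

    -- With N = suc n and t = n N - h this says X / Y ≥ (n / N) (1 - h / (n N)).
    choose-pred-≥ : ∀ {h t} → t + h ≡ n * suc n → suc n * i ≤ h * suc a →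
      Y * (n * t) ≤ X * (suc n * (n * suc n))
    choose-pred-≥ {h} {t} t+h≡ Ni≤ = *-cancelʳ-≤ _ _ (suc a) (begin
      Y * (n * t) * suc a                 ≡⟨ rearrange₁ Y n t (suc a) ⟩
      Y * (n * (t * suc a))               ≤⟨ *-monoʳ-≤ Y (*-monoʳ-≤ n bound) ⟩
      Y * (n * (suc n * (suc n * d)))     ≡⟨ rearrange₂ Y n (suc n) d ⟩
      Y * d * (suc n * (n * suc n))       ≡⟨ cong (_* (suc n * (n * suc n))) (choose-pred m d a m+d≡) ⟨
      X * suc a * (suc n * (n * suc n))   ≡⟨ rearrange₃ X (suc a) _ ⟩
      X * (suc n * (n * suc n)) * suc a   ∎)
      where
      open ≤-Reasoning
      open +-*-Solver
      rearrange₁ : ∀ y n t a → y * (n * t) * a ≡ y * (n * (t * a))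
      rearrange₁ = solve 4 (λ y n t a → y :* (n :* t) :* a := y :* (n :* (t :* a))) refl
      rearrange₂ : ∀ y n N d → y * (n * (N * (N * d))) ≡ y * d * (N * (n * N))
      rearrange₂ = solve 4 (λ y n N d → y :* (n :* (N :* (N :* d))) := y :* d :* (N :* (n :* N))) refl
      rearrange₃ : ∀ x a z → x * a * z ≡ x * z * a
      rearrange₃ = solve 3 (λ x a z → x :* a :* z := x :* z :* a) refl
      bound : t * suc a ≤ suc n * (suc n * d)
      bound = +-cancelʳ-≤ (h * suc a) _ _ (begin
        t * suc a + h * suc a                 ≡⟨ *-distribʳ-+ (suc a) t h ⟨
        (t + h) * suc a                       ≡⟨ cong₂ _*_ t+h≡ (sym m+d≡) ⟩
        n * suc n * (m + d)                   ≡⟨ solve 3 (λ n N s → n :* N :* s := N :* (s :* n)) refl n (suc n) (m + d) ⟩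
        suc n * ((m + d) * n)                 ≡⟨ cong (suc n *_) balance ⟩
        suc n * (i + suc n * d)               ≡⟨ *-distribˡ-+ (suc n) i (suc n * d) ⟩
        suc n * i + suc n * (suc n * d)       ≡⟨ +-comm (suc n * i) _ ⟩
        suc n * (suc n * d) + suc n * i       ≤⟨ +-monoʳ-≤ (suc n * (suc n * d)) Ni≤ ⟩
        suc n * (suc n * d) + h * suc a       ∎)

  module _ {k n m i : ℕ} (2k≤n : 2 * k ≤ n) (n<m : n < m) (i≤kn : i ≤ k * n) where
    private
      i≤nm : i ≤ n * m
      i≤nm = begin
        i        ≤⟨ i≤kn ⟩
        k * n    ≤⟨ *-monoˡ-≤ n (≤-trans (m≤m+n k _) (≤-trans 2k≤n (<⇒≤ n<m))) ⟩
        m * n    ≡⟨ *-comm m n ⟩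
        n * m    ∎
        where open ≤-Reasoning
      d = n * m ∸ i
      i+d≡ : i + d ≡ n * m
      i+d≡ = m+[n∸m]≡n i≤nm
      a = suc n * m ∸ suc i
      0<m : 0 < m
      0<m = ≤-<-trans z≤n n<m
      i<M : i < suc n * m
      i<M = ≤-<-trans i≤nm (m<n+m (n * m) 0<m)
      suc-a : suc a ≡ suc n * m ∸ i
      suc-a = sym (+-∸-assoc 1 i<M)
      m+d≡ : m + d ≡ suc a
      m+d≡ = trans (sym (+-∸-assoc m i≤nm)) (sym suc-a)

    choose-step-≤ : ((suc n * m ∸ suc i) C m) * suc n ≤ ((suc n * m ∸ i) C m) * n
    choose-step-≤ = subst (λ b → (a C m) * suc n ≤ (b C m) * n) suc-a
      (choose-pred-≤ {n} {m} {i} {d} {a} m+d≡ i+d≡)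

    -- Relative to r, the factor with index i loses i / (n (M - i)). From i ≤ k n and M - i ≥ n N /
    -- 2 the loss is at most 2k / (n N), which is the origin of the constant 2k.
    choose-step-≥ : ∀ {t} → t + 2 * k ≡ n * suc n →
      ((suc n * m ∸ i) C m) * (n * t) ≤ ((suc n * m ∸ suc i) C m) * (suc n * (n * suc n))
    choose-step-≥ {t} t+2k≡ = subst (λ b → (b C m) * (n * t) ≤ (a C m) * (suc n * (n * suc n))) suc-a
      (choose-pred-≥ {n} {m} {i} {d} {a} m+d≡ i+d≡ {2 * k} t+2k≡ (begin
        suc n * i                    ≤⟨ *-monoʳ-≤ (suc n) i≤kn ⟩
        suc n * (k * n)              ≡⟨ solve 3 (λ N k n → N :* (k :* n) := k :* (N :* n)) refl (suc n) k n ⟩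
        k * (suc n * n)              ≤⟨ *-monoʳ-≤ k half ⟩
        k * (2 * suc a)              ≡⟨ solve 2 (λ k a → k :* (con 2 :* a) := con 2 :* k :* a) refl k (suc a) ⟩
        2 * k * suc a                ∎))
      where
      open ≤-Reasoning
      open +-*-Solver
      -- This is M - i ≥ n N / 2 with M = N m: both N n ≤ M and 2 i ≤ 2 k n ≤ M hold, because n < m
      -- and 2k ≤ n.
      half : suc n * n ≤ 2 * suc a
      half = +-cancelʳ-≤ (2 * i) _ _ (begin
        suc n * n + 2 * i            ≤⟨ +-mono-≤ (*-monoʳ-≤ (suc n) (<⇒≤ n<m)) (*-monoʳ-≤ 2 i≤kn) ⟩
        suc n * m + 2 * (k * n)      ≡⟨ cong (suc n * m +_) (*-assoc 2 k n) ⟨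
        suc n * m + 2 * k * n        ≤⟨ +-monoʳ-≤ (suc n * m) (*-mono-≤ (≤-trans 2k≤n (n≤1+n n)) (<⇒≤ n<m)) ⟩
        suc n * m + suc n * m        ≡⟨ solve 1 (λ x → x :+ x := con 2 :* x) refl (suc n * m) ⟩
        2 * (suc n * m)              ≡⟨ cong (2 *_) (m∸n+n≡m (<⇒≤ i<M)) ⟨
        2 * (suc n * m ∸ i + i)      ≡⟨ *-distribˡ-+ 2 (suc n * m ∸ i) i ⟩
        2 * (suc n * m ∸ i) + 2 * i  ≡⟨ cong (λ b → 2 * b + 2 * i) suc-a ⟨
        2 * suc a + 2 * i            ∎)

-- Inequalities for powers

module Exponential where
  open SeriesLemmas using (u; 0≤u)
  open RationalLemmas using (*-mono-nonNeg; 0<1)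
  open RationalConversion
  open import Algebra.Bundles using (CommutativeRing)
  open import Data.Nat.Base as ℕ using (ℕ; zero; suc; _!)
  import Data.Nat.Properties as ℕₚ
  open import Data.Product.Base using (∃-syntax; _,_)
  open import Data.Rational.Base as ℚ using (ℚ; 0ℚ; 1ℚ; _+_; _-_; _*_; -_; _≤_; _<_)
  import Data.Rational.Properties as ℚₚ
  open import Data.Rational.Solver using (module +-*-Solver)
  open import Relation.Binary.PropositionalEquality
  open import Algebra.Properties.CommutativeSemiring.Exp
    (CommutativeRing.commutativeSemiring ℚₚ.+-*-commutativeRing)
    using (_^_; ^-assocʳ; ^-distrib-*)

  0≤1 : 0ℚ ≤ 1ℚ
  0≤1 = ℚₚ.<⇒≤ 0<1

  *-monoˡ : ∀ r {p q} → 0ℚ ≤ r → p ≤ q → r * p ≤ r * q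
  *-monoˡ r 0≤r = ℚₚ.*-monoˡ-≤-nonNeg r {{ℚ.nonNegative 0≤r}}

  *-monoʳ : ∀ r {p q} → 0ℚ ≤ r → p ≤ q → p * r ≤ q * r
  *-monoʳ r 0≤r = ℚₚ.*-monoʳ-≤-nonNeg r {{ℚ.nonNegative 0≤r}}

  0≤* : ∀ {p q} → 0ℚ ≤ p → 0ℚ ≤ q → 0ℚ ≤ p * q
  0≤* {p} {q} 0≤p 0≤q = subst (_≤ p * q) (ℚₚ.*-zeroʳ p) (*-monoˡ p 0≤p 0≤q)

  p≤p+q : ∀ p {q} → 0ℚ ≤ q → p ≤ p + q
  p≤p+q p {q} 0≤q = subst (_≤ p + q) (ℚₚ.+-identityʳ p) (ℚₚ.+-monoʳ-≤ p 0≤q)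

  +-cancelʳ-≤ : ∀ r p q → p + r ≤ q + r → p ≤ q
  +-cancelʳ-≤ r p q h = subst₂ _≤_ (cancel p r) (cancel q r) (ℚₚ.+-monoˡ-≤ (- r) h)
    where
    cancel : ∀ p r → p + r + - r ≡ p
    cancel = solve 2 (λ p r → p :+ r :+ :- r := p) refl
      where open +-*-Solver

  ι-suc : ∀ n → ι (suc n) ≡ 1ℚ + ι n
  ι-suc = ι-+ 1

  0≤^ : ∀ {p} n → 0ℚ ≤ p → 0ℚ ≤ p ^ n
  0≤^ zero    0≤p = 0≤1
  0≤^ (suc n) 0≤p = 0≤* 0≤p (0≤^ n 0≤p)

  ^-mono-≤ : ∀ {p q} n → 0ℚ ≤ p → p ≤ q → p ^ n ≤ q ^ n
  ^-mono-≤ zero    0≤p p≤q = ℚₚ.≤-refl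
  ^-mono-≤ (suc n) 0≤p p≤q = *-mono-nonNeg (0≤^ n 0≤p) (ℚₚ.≤-trans 0≤p p≤q) p≤q (^-mono-≤ n 0≤p p≤q)

  1^n≡1 : ∀ n → 1ℚ ^ n ≡ 1ℚ
  1^n≡1 zero    = refl
  1^n≡1 (suc n) = trans (ℚₚ.*-identityˡ (1ℚ ^ n)) (1^n≡1 n)

  1≤^ : ∀ {p} n → 1ℚ ≤ p → 1ℚ ≤ p ^ n
  1≤^ {p} n 1≤p = subst (_≤ p ^ n) (1^n≡1 n) (^-mono-≤ n 0≤1 1≤p)

  module _ (g : ℕ → ℚ) {r : ℚ} (0≤r : 0ℚ ≤ r) where
    private
      ^-suc : ∀ c → g 0 * r ^ c * r ≡ g 0 * r ^ suc c
      ^-suc c = trans (ℚₚ.*-assoc (g 0) (r ^ c) r) (cong (g 0 *_) (ℚₚ.*-comm (r ^ c) r))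

    -- A telescoping product bounded without forming the quotients of consecutive values. Later g i
    -- is the binomial coefficient of M - i over m, whose ratios are under control only for i < c.
    geometric-≤ : ∀ c → (∀ i → i ℕ.< c → g (suc i) ≤ g i * r) → g c ≤ g 0 * r ^ c
    geometric-≤ zero    step = ℚₚ.≤-reflexive (sym (ℚₚ.*-identityʳ (g 0)))
    geometric-≤ (suc c) step = ℚₚ.≤-trans (step c (ℕₚ.n<1+n c)) (subst (g c * r ≤_) (^-suc c)
      (*-monoʳ r 0≤r (geometric-≤ c λ i i<c → step i (ℕₚ.m<n⇒m<1+n i<c))))

    geometric-≥ : ∀ c → (∀ i → i ℕ.< c → g i * r ≤ g (suc i)) → g 0 * r ^ c ≤ g c
    geometric-≥ zero    step = ℚₚ.≤-reflexive (ℚₚ.*-identityʳ (g 0))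
    geometric-≥ (suc c) step = ℚₚ.≤-trans (subst (_≤ g c * r) (^-suc c)
      (*-monoʳ r 0≤r (geometric-≥ c λ i i<c → step i (ℕₚ.m<n⇒m<1+n i<c)))) (step c (ℕₚ.n<1+n c))

  -- This is (1 - x)^c ≥ 1 - c x with s for 1 - x and the subtraction moved across. The induction
  -- writes 1 as s * 1 + x, applies the hypothesis to that 1, and uses s ≤ 1 on the linear term.
  bernoulli : ∀ {s x} c → 0ℚ ≤ s → 0ℚ ≤ x → s + x ≡ 1ℚ → 1ℚ ≤ s ^ c + ι c * x
  bernoulli {s} {x} zero    0≤s 0≤x s+x≡1 = p≤p+q 1ℚ (0≤* (0≤ι 0) 0≤x)
  bernoulli {s} {x} (suc c) 0≤s 0≤x s+x≡1 = begin
    1ℚ                               ≡⟨ s+x≡1 ⟨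
    s + x                            ≡⟨ cong (_+ x) (ℚₚ.*-identityʳ s) ⟨
    s * 1ℚ + x                       ≤⟨ ℚₚ.+-monoˡ-≤ x (*-monoˡ s 0≤s (bernoulli c 0≤s 0≤x s+x≡1)) ⟩
    s * (s ^ c + ι c * x) + x        ≡⟨ cong (_+ x) (ℚₚ.*-distribˡ-+ s (s ^ c) (ι c * x)) ⟩
    s ^ suc c + s * (ι c * x) + x    ≤⟨ ℚₚ.+-monoˡ-≤ x (ℚₚ.+-monoʳ-≤ (s ^ suc c)
                                          (*-monoʳ (ι c * x) (0≤* (0≤ι c) 0≤x) s≤1)) ⟩
    s ^ suc c + 1ℚ * (ι c * x) + x   ≡⟨ collect (s ^ suc c) (ι c) x ⟩
    s ^ suc c + (1ℚ + ι c) * x       ≡⟨ cong (λ i → s ^ suc c + i * x) (ι-suc c) ⟨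
    s ^ suc c + ι (suc c) * x        ∎
    where
    open ℚₚ.≤-Reasoning
    s≤1 : s ≤ 1ℚ
    s≤1 = subst (s ≤_) s+x≡1 (p≤p+q s 0≤x)
    collect : ∀ p i x → p + 1ℚ * (i * x) + x ≡ p + (1ℚ + i) * x
    collect = solve 3 (λ p i x → p :+ con 1ℚ :* (i :* x) :+ x := p :+ (con 1ℚ :+ i) :* x) refl
      where open +-*-Solver

  -- Since y ≤ 1, the quadratic term K y² is absorbed into K y, so each step replaces K by 2 K + 1
  -- and the witness is 2^k - 1.
  [1+y]^k≤1+Ky : ∀ k → ∃[ K ] (∀ y → 0ℚ ≤ y → y ≤ 1ℚ → (1ℚ + y) ^ k ≤ 1ℚ + ι K * y)
  [1+y]^k≤1+Ky zero    = 0 , λ y 0≤y y≤1 → p≤p+q 1ℚ (0≤* (0≤ι 0) 0≤y)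
  [1+y]^k≤1+Ky (suc k) with [1+y]^k≤1+Ky k
  ... | K , bound = suc (K ℕ.+ K) , λ y 0≤y y≤1 → begin
    (1ℚ + y) * (1ℚ + y) ^ k                    ≤⟨ *-monoˡ (1ℚ + y) (ℚₚ.≤-trans 0≤1 (p≤p+q 1ℚ 0≤y)) (bound y 0≤y y≤1) ⟩
    (1ℚ + y) * (1ℚ + ι K * y)                  ≡⟨ expand y (ι K) ⟩
    1ℚ + (1ℚ + ι K) * y + y * (ι K * y)        ≤⟨ ℚₚ.+-monoʳ-≤ (1ℚ + (1ℚ + ι K) * y) (*-monoʳ (ι K * y) (0≤* (0≤ι K) 0≤y) y≤1) ⟩
    1ℚ + (1ℚ + ι K) * y + 1ℚ * (ι K * y)       ≡⟨ collect y (ι K) ⟩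
    1ℚ + (1ℚ + (ι K + ι K)) * y                ≡⟨ cong (λ i → 1ℚ + (1ℚ + i) * y) (ι-+ K K) ⟨
    1ℚ + (1ℚ + ι (K ℕ.+ K)) * y                ≡⟨ cong (λ i → 1ℚ + i * y) (ι-suc (K ℕ.+ K)) ⟨
    1ℚ + ι (suc (K ℕ.+ K)) * y                 ∎
    where
    open ℚₚ.≤-Reasoning
    open +-*-Solver
    expand : ∀ y K → (1ℚ + y) * (1ℚ + K * y) ≡ 1ℚ + (1ℚ + K) * y + y * (K * y)
    expand = solve 2 (λ y K → (con 1ℚ :+ y) :* (con 1ℚ :+ K :* y) := con 1ℚ :+ (con 1ℚ :+ K) :* y :+ y :* (K :* y)) refl
    collect : ∀ y K → 1ℚ + (1ℚ + K) * y + 1ℚ * (K * y) ≡ 1ℚ + (1ℚ + (K + K)) * y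
    collect = solve 2 (λ y K → con 1ℚ :+ (con 1ℚ :+ K) :* y :+ con 1ℚ :* (K :* y) := con 1ℚ :+ (con 1ℚ :+ (K :+ K)) :* y) refl

  module _ {t y : ℚ} (0≤t : 0ℚ ≤ t) (0≤y : 0ℚ ≤ y) where
    private
      0≤t+y : 0ℚ ≤ t + y
      0≤t+y = ℚₚ.≤-trans 0≤t (p≤p+q t 0≤y)
      open +-*-Solver

    -- A mean value estimate: the slope of a power over [t, t + y] is at least the derivative at the
    -- left end, as that derivative increases. The companion `^-difference-≤` uses the right end.
    ^-difference-≥ : ∀ i → t ^ suc i + ι (suc i) * y * t ^ i ≤ (t + y) ^ suc i
    ^-difference-≥ zero    = ℚₚ.≤-reflexive
      (solve 2 (λ t y → t :* con 1ℚ :+ con 1ℚ :* y :* con 1ℚ := (t :+ y) :* con 1ℚ) refl t y)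
    ^-difference-≥ (suc i) = begin
      t * p + ι (suc (suc i)) * y * p             ≡⟨ cong (λ c → t * p + c * y * p) (ι-suc (suc i)) ⟩
      t * p + (1ℚ + ι (suc i)) * y * p            ≡⟨ collect t y (ι (suc i)) (t ^ i) ⟩
      t * (p + ι (suc i) * y * t ^ i) + y * p     ≤⟨ ℚₚ.+-mono-≤ (*-monoˡ t 0≤t (^-difference-≥ i))
                                                       (*-monoˡ y 0≤y (^-mono-≤ (suc i) 0≤t (p≤p+q t 0≤y))) ⟩
      t * (t + y) ^ suc i + y * (t + y) ^ suc i   ≡⟨ ℚₚ.*-distribʳ-+ ((t + y) ^ suc i) t y ⟨
      (t + y) * (t + y) ^ suc i                   ∎
      where
      open ℚₚ.≤-Reasoning
      p = t ^ suc i
      collect : ∀ t y c q → t * (t * q) + (1ℚ + c) * y * (t * q) ≡ t * (t * q + c * y * q) + y * (t * q)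
      collect = solve 4 (λ t y c q → t :* (t :* q) :+ (con 1ℚ :+ c) :* y :* (t :* q) :=
        t :* (t :* q :+ c :* y :* q) :+ y :* (t :* q)) refl

    ^-difference-≤ : ∀ i → (t + y) ^ suc i ≤ t ^ suc i + ι (suc i) * y * (t + y) ^ i
    ^-difference-≤ zero    = ℚₚ.≤-reflexive
      (solve 2 (λ t y → (t :+ y) :* con 1ℚ := t :* con 1ℚ :+ con 1ℚ :* y :* con 1ℚ) refl t y)
    ^-difference-≤ (suc i) = begin
      (t + y) * p                                    ≡⟨ ℚₚ.*-distribʳ-+ p t y ⟩
      t * p + y * p                                  ≤⟨ ℚₚ.+-monoˡ-≤ (y * p) (*-monoˡ t 0≤t (^-difference-≤ i)) ⟩
      t * (t ^ suc i + c * y * (t + y) ^ i) + y * p  ≡⟨ spread t y (t ^ suc i) c ((t + y) ^ i) p ⟩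
      t * t ^ suc i + y * p + t * (c * y * (t + y) ^ i)
        ≤⟨ ℚₚ.+-monoʳ-≤ (t * t ^ suc i + y * p) (*-monoʳ (c * y * (t + y) ^ i)
             (0≤* (0≤* (0≤ι (suc i)) 0≤y) (0≤^ i 0≤t+y)) (p≤p+q t 0≤y)) ⟩
      t * t ^ suc i + y * p + (t + y) * (c * y * (t + y) ^ i)
                                                     ≡⟨ collect (t + y) y (t ^ suc (suc i)) c ((t + y) ^ i) ⟩
      t ^ suc (suc i) + (1ℚ + c) * y * p             ≡⟨ cong (λ c → t ^ suc (suc i) + c * y * p) (ι-suc (suc i)) ⟨
      t ^ suc (suc i) + ι (suc (suc i)) * y * p      ∎
      where
      open ℚₚ.≤-Reasoning
      p = (t + y) ^ suc i
      c = ι (suc i)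
      spread : ∀ t y s c q p → t * (s + c * y * q) + y * p ≡ t * s + y * p + t * (c * y * q)
      spread = solve 6 (λ t y s c q p → t :* (s :+ c :* y :* q) :+ y :* p := t :* s :+ y :* p :+ t :* (c :* y :* q)) refl
      collect : ∀ v y s c q → s + y * (v * q) + v * (c * y * q) ≡ s + (1ℚ + c) * y * (v * q)
      collect = solve 5 (λ v y s c q → s :+ y :* (v :* q) :+ v :* (c :* y :* q) := s :+ (con 1ℚ :+ c) :* y :* (v :* q)) refl

  -- Taylor polynomials of the exponential function

  expTerm : ℕ → ℚ → ℚ
  expTerm i t = t ^ i * u (i !) {{i ℕₚ.!≢0}}

  -- The Taylor polynomial of exp with j terms. The free argument makes it possible to reach
  -- `eSum j`, its value at 1, from 0 by many small steps.
  expSum : ℕ → ℚ → ℚ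
  expSum zero    t = 0ℚ
  expSum (suc j) t = expSum j t + expTerm j t

  expSum-1 : ∀ j → expSum j 1ℚ ≡ eSum j
  expSum-1 zero    = refl
  expSum-1 (suc j) = cong₂ _+_ (expSum-1 j)
    (trans (cong (_* u (j !) {{j ℕₚ.!≢0}}) (1^n≡1 j)) (ℚₚ.*-identityˡ _))

  expSum-0 : ∀ j → expSum (suc j) 0ℚ ≡ 1ℚ
  expSum-0 zero    = refl
  expSum-0 (suc j) = trans (cong (expSum (suc j) 0ℚ +_)
      (trans (cong (_* u (suc j !) {{suc j ℕₚ.!≢0}}) (ℚₚ.*-zeroˡ (0ℚ ^ j))) (ℚₚ.*-zeroˡ (u (suc j !) {{suc j ℕₚ.!≢0}}))))
    (trans (ℚₚ.+-identityʳ _) (expSum-0 j))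

  0≤expTerm : ∀ i {t} → 0ℚ ≤ t → 0ℚ ≤ expTerm i t
  0≤expTerm i 0≤t = 0≤* (0≤^ i 0≤t) (0≤u (i !) {{i ℕₚ.!≢0}})

  0≤expSum : ∀ j {t} → 0ℚ ≤ t → 0ℚ ≤ expSum j t
  0≤expSum zero    0≤t = ℚₚ.≤-refl
  0≤expSum (suc j) 0≤t = ℚₚ.+-mono-≤ (0≤expSum j 0≤t) (0≤expTerm j 0≤t)

  factorial-recip : ∀ i → ι (suc i) * u (suc i !) {{suc i ℕₚ.!≢0}} ≡ u (i !) {{i ℕₚ.!≢0}}
  factorial-recip i = *-cancelʳ (ι (i !)) {{ι-positive (i !)}} (begin
    ι (suc i) * v * ι (i !)     ≡⟨ solve 3 (λ a v b → a :* v :* b := v :* (a :* b)) refl (ι (suc i)) v (ι (i !)) ⟩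
    v * (ι (suc i) * ι (i !))   ≡⟨ cong (v *_) (ι-* (suc i) (i !)) ⟨
    v * ι (suc i !)             ≡⟨ u*ι (suc i !) ⟩
    1ℚ                          ≡⟨ u*ι (i !) ⟨
    u (i !) * ι (i !)           ∎)
    where
    open ≡-Reasoning
    open +-*-Solver
    instance
      _ = i ℕₚ.!≢0
      _ = suc i ℕₚ.!≢0
    v = u (suc i !)

  term-factor : ∀ i t y p → (t + ι (suc i) * y * p) * u (suc i !) {{suc i ℕₚ.!≢0}} ≡
    t * u (suc i !) {{suc i ℕₚ.!≢0}} + y * (p * u (i !) {{i ℕₚ.!≢0}})
  term-factor i t y p = trans
    (solve 5 (λ t c y p v → (t :+ c :* y :* p) :* v := t :* v :+ y :* (p :* (c :* v))) refl t (ι (suc i)) y p v)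
    (cong (λ w → t * v + y * (p * w)) (factorial-recip i))
    where
    open +-*-Solver
    v = u (suc i !) {{suc i ℕₚ.!≢0}}

  module _ {t y : ℚ} (0≤t : 0ℚ ≤ t) (0≤y : 0ℚ ≤ y) where
    private
      0≤t+y : 0ℚ ≤ t + y
      0≤t+y = ℚₚ.≤-trans 0≤t (p≤p+q t 0≤y)

      regroup : ∀ a b c d y → a + y * b + (c + y * d) ≡ a + c + y * (b + d)
      regroup = solve 5 (λ a b c d y → a :+ y :* b :+ (c :+ y :* d) := a :+ c :+ y :* (b :+ d)) refl
        where open +-*-Solver

    -- Both bounds express that the derivative of expSum (suc j) is expSum j,
    -- which is increasing.
    expSum-difference-≥ : ∀ j → expSum (suc j) t + y * expSum j t ≤ expSum (suc j) (t + y)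
    expSum-difference-≥ zero    = ℚₚ.≤-reflexive
      (trans (cong (expSum 1 t +_) (ℚₚ.*-zeroʳ y)) (ℚₚ.+-identityʳ _))
    expSum-difference-≥ (suc j) = subst (_≤ expSum (suc (suc j)) (t + y))
      (regroup (expSum (suc j) t) (expSum j t) (expTerm (suc j) t) (expTerm j t) y)
      (ℚₚ.+-mono-≤ (expSum-difference-≥ j)
        (subst (_≤ expTerm (suc j) (t + y)) (term-factor j (t ^ suc j) y (t ^ j))
          (*-monoʳ _ (0≤u (suc j !) {{suc j ℕₚ.!≢0}}) (^-difference-≥ 0≤t 0≤y j))))

    expSum-difference-≤′ : ∀ j → expSum (suc j) (t + y) ≤ expSum (suc j) t + y * expSum j (t + y)
    expSum-difference-≤′ zero    = ℚₚ.≤-reflexive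
      (sym (trans (cong (expSum 1 t +_) (ℚₚ.*-zeroʳ y)) (ℚₚ.+-identityʳ _)))
    expSum-difference-≤′ (suc j) = subst (expSum (suc (suc j)) (t + y) ≤_)
      (regroup (expSum (suc j) t) (expSum j (t + y)) (expTerm (suc j) t) (expTerm j (t + y)) y)
      (ℚₚ.+-mono-≤ (expSum-difference-≤′ j)
        (subst (expTerm (suc j) (t + y) ≤_) (term-factor j (t ^ suc j) y ((t + y) ^ j))
          (*-monoʳ _ (0≤u (suc j !) {{suc j ℕₚ.!≢0}}) (^-difference-≤ 0≤t 0≤y j))))

    expSum-difference-≤ : ∀ j → expSum (suc j) (t + y) ≤ expSum (suc j) t + y * expSum (suc j) (t + y)
    expSum-difference-≤ j = ℚₚ.≤-trans (expSum-difference-≤′ j)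
      (ℚₚ.+-monoʳ-≤ (expSum (suc j) t) (*-monoˡ y 0≤y (p≤p+q (expSum j (t + y)) (0≤expTerm j 0≤t+y))))

    -- In `expSum-difference-≤` the same value F stands on both sides; solving for it leaves (1 - y)
    -- F on the left, and s is 1 - y.
    expSum-decay : ∀ {s} j → s + y ≡ 1ℚ → s * expSum (suc j) (t + y) ≤ expSum (suc j) t
    expSum-decay {s} j s+y≡1 = +-cancelʳ-≤ (y * F) _ _ (begin
      s * F + y * F               ≡⟨ ℚₚ.*-distribʳ-+ F s y ⟨
      (s + y) * F                 ≡⟨ cong (_* F) s+y≡1 ⟩
      1ℚ * F                      ≡⟨ ℚₚ.*-identityˡ F ⟩
      F                           ≤⟨ expSum-difference-≤ j ⟩
      expSum (suc j) t + y * F    ∎)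
      where
      open ℚₚ.≤-Reasoning
      F = expSum (suc j) (t + y)

  ι-suc-* : ∀ r y → ι (suc r) * y ≡ ι r * y + y
  ι-suc-* r y = trans (cong (_* y) (ι-suc r))
    (solve 2 (λ r y → (con 1ℚ :+ r) :* y := r :* y :+ y) refl (ι r) y)
    where open +-*-Solver

  -- Walking back from r y to 0 in r steps spends one factor s per step and ends at the value 1.
  expSum-decay^ : ∀ {s y} r j → 0ℚ ≤ s → 0ℚ ≤ y → s + y ≡ 1ℚ → s ^ r * expSum (suc j) (ι r * y) ≤ 1ℚ
  expSum-decay^ {s} {y} zero j 0≤s 0≤y s+y≡1 = ℚₚ.≤-reflexive (trans (ℚₚ.*-identityˡ _)
    (trans (cong (expSum (suc j)) (ℚₚ.*-zeroˡ y)) (expSum-0 j)))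
  expSum-decay^ {s} {y} (suc r) j 0≤s 0≤y s+y≡1 = begin
    s * s ^ r * expSum (suc j) (ι (suc r) * y)   ≡⟨ cong (λ t → s * s ^ r * expSum (suc j) t) (ι-suc-* r y) ⟩
    s * s ^ r * F                                ≡⟨ solve 3 (λ s p F → s :* p :* F := p :* (s :* F)) refl s (s ^ r) F ⟩
    s ^ r * (s * F)                              ≤⟨ *-monoˡ (s ^ r) (0≤^ r 0≤s) (expSum-decay (0≤* (0≤ι r) 0≤y) 0≤y {s} j s+y≡1) ⟩
    s ^ r * expSum (suc j) (ι r * y)             ≤⟨ expSum-decay^ r j 0≤s 0≤y s+y≡1 ⟩
    1ℚ                                           ∎
    where
    open ℚₚ.≤-Reasoning
    open +-*-Solver
    F = expSum (suc j) (ι r * y + y)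

  -- Each step of length y gains a factor 1 + y. The derivative has one term fewer than the
  -- polynomial, so every step admits one more term; this is why the number of terms grows with r.
  expSum-growth : ∀ {y} r → 0ℚ ≤ y → (1ℚ + y) ^ r ≤ expSum (suc r) (ι r * y)
  expSum-growth {y} zero    0≤y = ℚₚ.≤-refl
  expSum-growth {y} (suc r) 0≤y = begin
    (1ℚ + y) * (1ℚ + y) ^ r                   ≤⟨ *-monoˡ (1ℚ + y) (ℚₚ.≤-trans 0≤1 (p≤p+q 1ℚ 0≤y)) (expSum-growth r 0≤y) ⟩
    (1ℚ + y) * F                              ≡⟨ solve 2 (λ y F → (con 1ℚ :+ y) :* F := F :+ y :* F) refl y F ⟩
    F + y * F                                 ≤⟨ ℚₚ.+-monoˡ-≤ (y * F) (p≤p+q F (0≤expTerm (suc r) 0≤ry)) ⟩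
    expSum (suc (suc r)) (ι r * y) + y * F    ≤⟨ expSum-difference-≥ 0≤ry 0≤y (suc r) ⟩
    expSum (suc (suc r)) (ι r * y + y)        ≡⟨ cong (expSum (suc (suc r))) (ι-suc-* r y) ⟨
    expSum (suc (suc r)) (ι (suc r) * y)      ∎
    where
    open ℚₚ.≤-Reasoning
    open +-*-Solver
    0≤ry = 0≤* (0≤ι r) 0≤y
    F = expSum (suc r) (ι r * y)

-- Two-sided bounds for the proportion times a power of a partial sum of e

module Estimate where
  open SeriesLemmas using (u; 0≤u; eSum-mono)
  open RationalConversion
  open BinomialRatio
  open Exponential
  open import Algebra.Bundles using (CommutativeRing)
  open import Data.Nat.Base as ℕ using (ℕ; suc; NonZero; z≤n; s≤s; _∸_)
  open import Data.Nat.Combinatorics using (_C_)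
  import Data.Nat.Properties as ℕₚ
  open import Data.Product.Base using (proj₁; proj₂)
  open import Data.Rational.Base as ℚ using (ℚ; 0ℚ; 1ℚ; _+_; _*_; _≤_)
  import Data.Rational.Properties as ℚₚ
  open import Data.Rational.Solver using (module +-*-Solver)
  open import Relation.Binary.PropositionalEquality
  open import Algebra.Properties.CommutativeSemiring.Exp
    (CommutativeRing.commutativeSemiring ℚₚ.+-*-commutativeRing)
    using (_^_; ^-assocʳ; ^-distrib-*)

  u-anti : ∀ {m n} .{{_ : NonZero m}} .{{_ : NonZero n}} → m ℕ.≤ n → u n ≤ u m
  u-anti {m} {n} m≤n = ℚₚ.*-cancelʳ-≤-pos (ι n) {{ι-positive n}} (begin
    u n * ι n    ≡⟨ u*ι n ⟩
    1ℚ           ≡⟨ u*ι m ⟨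
    u m * ι m    ≤⟨ *-monoˡ (u m) (0≤u m) (ι-mono-≤ m≤n) ⟩
    u m * ι n    ∎)
    where open ℚₚ.≤-Reasoning

  u≤1 : ∀ n .{{_ : NonZero n}} → u n ≤ 1ℚ
  u≤1 (suc n) = u-anti {1} {suc n} (s≤s z≤n)

  module _ (n : ℕ) .{{_ : NonZero n}} where
    private
      N = suc n
      y = u n

    ρ : ℚ
    ρ = ι n * u N

    0≤ρ : 0ℚ ≤ ρ
    0≤ρ = 0≤* (0≤ι n) (0≤u N)

    ρ*ιN : ρ * ι N ≡ ι n
    ρ*ιN = *-u-cancelʳ (ι n) N

    ρ+u≡1 : ρ + u N ≡ 1ℚ
    ρ+u≡1 = begin
      ι n * u N + u N      ≡⟨ solve 2 (λ n v → n :* v :+ v := v :* (con 1ℚ :+ n)) refl (ι n) (u N) ⟩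
      u N * (1ℚ + ι n)     ≡⟨ cong (u N *_) (ι-suc n) ⟨
      u N * ι N            ≡⟨ u*ι N ⟩
      1ℚ                   ∎
      where
      open ≡-Reasoning
      open +-*-Solver

    ρ≤1 : ρ ≤ 1ℚ
    ρ≤1 = subst (ρ ≤_) ρ+u≡1 (p≤p+q ρ (0≤u N))

    [1+y]ρ≡1 : (1ℚ + y) * ρ ≡ 1ℚ
    [1+y]ρ≡1 = begin
      (1ℚ + y) * (ι n * u N)         ≡⟨ solve 3 (λ y n v → (con 1ℚ :+ y) :* (n :* v) := n :* v :+ y :* n :* v) refl y (ι n) (u N) ⟩
      ι n * u N + y * ι n * u N      ≡⟨ cong (λ w → ι n * u N + w * u N) (u*ι n) ⟩
      ι n * u N + 1ℚ * u N           ≡⟨ cong (ι n * u N +_) (ℚₚ.*-identityˡ (u N)) ⟩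
      ρ + u N                        ≡⟨ ρ+u≡1 ⟩
      1ℚ                             ∎
      where
      open ≡-Reasoning
      open +-*-Solver

    module _ (j : ℕ) (n<j : n ℕ.< j) where
      private
        E = eSum j
        z = ρ ^ n * E

      -- As `ρ` is inverse to 1 + 1/n, this is (1 + 1/n)^n ≤ `eSum j`. The n steps of length 1/n end
      -- at 1 with n + 1 terms, whence the cutoff n < j.
      1≤ρ^n*e : 1ℚ ≤ ρ ^ n * eSum j
      1≤ρ^n*e = begin
        1ℚ                                     ≡⟨ 1^n≡1 n ⟨
        1ℚ ^ n                                 ≡⟨ cong (_^ n) (trans (ℚₚ.*-comm ρ (1ℚ + y)) [1+y]ρ≡1) ⟨
        (ρ * (1ℚ + y)) ^ n                     ≡⟨ ^-distrib-* ρ (1ℚ + y) n ⟩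
        ρ ^ n * (1ℚ + y) ^ n                   ≤⟨ *-monoˡ (ρ ^ n) (0≤^ n 0≤ρ) (expSum-growth n (0≤u n)) ⟩
        ρ ^ n * expSum (suc n) (ι n * y)       ≡⟨ cong (λ t → ρ ^ n * expSum (suc n) t) (trans (ℚₚ.*-comm (ι n) y) (u*ι n)) ⟩
        ρ ^ n * expSum (suc n) 1ℚ              ≡⟨ cong (ρ ^ n *_) (expSum-1 (suc n)) ⟩
        ρ ^ n * eSum (suc n)                   ≤⟨ *-monoˡ (ρ ^ n) (0≤^ n 0≤ρ)
                                                    (subst (λ i → eSum (suc n) ≤ eSum i) (ℕₚ.m∸n+n≡m n<j)
                                                      (eSum-mono (suc n) (j ∸ suc n))) ⟩
        ρ ^ n * eSum j                         ∎
        where open ℚₚ.≤-Reasoning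

      -- The N steps of length 1/N bound the product with the N-th power of `ρ` by 1; removing one
      -- factor `ρ` costs 1 + 1/n.
      ρ^n*e≤1+y : ρ ^ n * eSum j ≤ 1ℚ + u n
      ρ^n*e≤1+y = begin
        z                                      ≡⟨ ℚₚ.*-identityˡ z ⟨
        1ℚ * z                                 ≡⟨ cong (_* z) [1+y]ρ≡1 ⟨
        (1ℚ + y) * ρ * z                       ≡⟨ solve 4 (λ y r p e → (con 1ℚ :+ y) :* r :* (p :* e) := (con 1ℚ :+ y) :* (r :* p :* e)) refl y ρ (ρ ^ n) E ⟩
        (1ℚ + y) * (ρ ^ N * E)                 ≤⟨ *-monoˡ (1ℚ + y) (ℚₚ.≤-trans 0≤1 (p≤p+q 1ℚ (0≤u n))) (decay j (ℕₚ.≤-trans (s≤s z≤n) n<j)) ⟩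
        (1ℚ + y) * 1ℚ                          ≡⟨ ℚₚ.*-identityʳ (1ℚ + y) ⟩
        1ℚ + y                                 ∎
        where
        open ℚₚ.≤-Reasoning
        open +-*-Solver
        decay : ∀ j → 1 ℕ.≤ j → ρ ^ N * eSum j ≤ 1ℚ
        decay (suc j) _ = subst (λ e → ρ ^ N * e ≤ 1ℚ)
          (trans (cong (expSum (suc j)) (trans (ℚₚ.*-comm (ι N) (u N)) (u*ι N))) (expSum-1 (suc j)))
          (expSum-decay^ N j 0≤ρ (0≤u N) ρ+u≡1)

  ^-pred : ∀ n {k} → 2 ℕ.≤ k → n ℕ.^ k ≡ n ℕ.* n ℕ.^ (k ∸ 1)
  ^-pred n {suc k} _ = refl

  -- Here k ≥ 2 is decisive, as the exponent must be at least 1. Applied to N it yields n < m, on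
  -- which the control of the factors rests.
  base≤^-pred : ∀ n {k} .{{_ : NonZero n}} → 2 ℕ.≤ k → n ℕ.≤ n ℕ.^ (k ∸ 1)
  base≤^-pred n {suc (suc k)} (s≤s (s≤s _)) = ℕₚ.m≤m*n n (n ℕ.^ k) {{ℕₚ.m^n≢0 n k}}

  module _ (k n : ℕ) .{{_ : NonZero n}} (2≤k : 2 ℕ.≤ k) (2k≤n : 2 ℕ.* k ℕ.≤ n) where
    private
      N = suc n
      M = N ℕ.^ k
      m = N ℕ.^ (k ∸ 1)
      c = suc (k ℕ.* n)
      D = n ℕ.* N
      instance
        M≢0 : NonZero M
        M≢0 = ℕₚ.m^n≢0 N k
        D≢0 : NonZero D
        D≢0 = ℕₚ.m*n≢0 n N
      a = expectedSafeProportion k N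
      g : ℕ → ℚ
      g i = ι ((M ∸ i) C m)

      M≡N*m : M ≡ N ℕ.* m
      M≡N*m = ^-pred N 2≤k

      n<m : n ℕ.< m
      n<m = base≤^-pred N 2≤k

      2k≤D : 2 ℕ.* k ℕ.≤ D
      2k≤D = ℕₚ.≤-trans 2k≤n (ℕₚ.m≤m*n n N)

      t = D ∸ 2 ℕ.* k
      t+2k≡D : t ℕ.+ 2 ℕ.* k ≡ D
      t+2k≡D = ℕₚ.m∸n+n≡m 2k≤D

      -- `x` is the bound 2k / (n N) for the relative loss of one factor, and `s` is 1 - `x`.
      s x : ℚ
      s = ι t * u D
      x = ι (2 ℕ.* k) * u D

      0≤s : 0ℚ ≤ s
      0≤s = 0≤* (0≤ι t) (0≤u D)
      0≤x : 0ℚ ≤ x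
      0≤x = 0≤* (0≤ι (2 ℕ.* k)) (0≤u D)

      s+x≡1 : s + x ≡ 1ℚ
      s+x≡1 = begin
        ι t * u D + ι (2 ℕ.* k) * u D     ≡⟨ ℚₚ.*-distribʳ-+ (u D) (ι t) (ι (2 ℕ.* k)) ⟨
        (ι t + ι (2 ℕ.* k)) * u D         ≡⟨ cong (_* u D) (ι-+ t (2 ℕ.* k)) ⟨
        ι (t ℕ.+ 2 ℕ.* k) * u D           ≡⟨ cong (λ d → ι d * u D) t+2k≡D ⟩
        ι D * u D                         ≡⟨ ℚₚ.*-comm (ι D) (u D) ⟩
        u D * ι D                         ≡⟨ u*ι D ⟩
        1ℚ                                ∎
        where open ≡-Reasoning

      proportion-step-≤ : ∀ i → i ℕ.< c → g (suc i) ≤ g i * ρ n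
      proportion-step-≤ i (s≤s i≤kn) = ℚₚ.*-cancelʳ-≤-pos (ι N) {{ι-positive N}} (begin
        ι A * ι N            ≡⟨ ι-* A N ⟨
        ι (A ℕ.* N)          ≤⟨ ι-mono-≤ (subst (λ M → ((M ∸ suc i) C m) ℕ.* N ℕ.≤ ((M ∸ i) C m) ℕ.* n)
                                  (sym M≡N*m) (choose-step-≤ {k} 2k≤n n<m i≤kn)) ⟩
        ι (B ℕ.* n)          ≡⟨ ι-* B n ⟩
        ι B * ι n            ≡⟨ cong (ι B *_) (ρ*ιN n) ⟨
        ι B * (ρ n * ι N)    ≡⟨ ℚₚ.*-assoc (ι B) (ρ n) (ι N) ⟨
        ι B * ρ n * ι N      ∎)
        where
        open ℚₚ.≤-Reasoning
        A = (M ∸ suc i) C m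
        B = (M ∸ i) C m

      proportion-step-≥ : ∀ i → i ℕ.< c → g i * (ρ n * s) ≤ g (suc i)
      proportion-step-≥ i (s≤s i≤kn) = ℚₚ.*-cancelʳ-≤-pos (ι (N ℕ.* D)) {{ι-positive (N ℕ.* D) {{ℕₚ.m*n≢0 N D}}}} (begin
        ι B * (ρ n * s) * ι (N ℕ.* D)           ≡⟨ cong (ι B * (ρ n * s) *_) (ι-* N D) ⟩
        ι B * (ρ n * s) * (ι N * ι D)           ≡⟨ solve 5 (λ b r s N D → b :* (r :* s) :* (N :* D) := b :* ((r :* N) :* (s :* D)))
                                                     refl (ι B) (ρ n) s (ι N) (ι D) ⟩
        ι B * ((ρ n * ι N) * (s * ι D))         ≡⟨ cong₂ (λ p q → ι B * (p * q)) (ρ*ιN n) (*-u-cancelʳ (ι t) D) ⟩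
        ι B * (ι n * ι t)                       ≡⟨ cong (ι B *_) (ι-* n t) ⟨
        ι B * ι (n ℕ.* t)                       ≡⟨ ι-* B (n ℕ.* t) ⟨
        ι (B ℕ.* (n ℕ.* t))                     ≤⟨ ι-mono-≤ (subst
                                                     (λ M → ((M ∸ i) C m) ℕ.* (n ℕ.* t) ℕ.≤ ((M ∸ suc i) C m) ℕ.* (N ℕ.* D))
                                                     (sym M≡N*m) (choose-step-≥ {k} 2k≤n n<m i≤kn t+2k≡D)) ⟩
        ι (A ℕ.* (N ℕ.* D))                     ≡⟨ ι-* A (N ℕ.* D) ⟩
        ι A * ι (N ℕ.* D)                       ∎)
        where
        open ℚₚ.≤-Reasoning
        open +-*-Solver
        A = (M ∸ suc i) C m
        B = (M ∸ i) C m

      0<g0 : ℚ.Positive (g 0)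
      0<g0 = ι-positive (M C m) {{choose≢0 (subst (m ℕ.≤_) (sym M≡N*m) (ℕₚ.m≤n*m m N))}}

      a≤ρ^c : a ≤ ρ n ^ c
      a≤ρ^c = ℚₚ.*-cancelʳ-≤-pos (g 0) {{0<g0}} (begin
        a * g 0              ≡⟨ expectedSafeProportion-ratio k n ⟩
        g c                  ≤⟨ geometric-≤ g (0≤ρ n) c proportion-step-≤ ⟩
        g 0 * ρ n ^ c        ≡⟨ ℚₚ.*-comm (g 0) (ρ n ^ c) ⟩
        ρ n ^ c * g 0        ∎)
        where open ℚₚ.≤-Reasoning

      [ρs]^c≤a : (ρ n * s) ^ c ≤ a
      [ρs]^c≤a = ℚₚ.*-cancelʳ-≤-pos (g 0) {{0<g0}} (begin
        (ρ n * s) ^ c * g 0  ≡⟨ ℚₚ.*-comm ((ρ n * s) ^ c) (g 0) ⟩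
        g 0 * (ρ n * s) ^ c  ≤⟨ geometric-≥ g (0≤* (0≤ρ n) 0≤s) c proportion-step-≥ ⟩
        g c                  ≡⟨ expectedSafeProportion-ratio k n ⟨
        a * g 0              ∎)
        where open ℚₚ.≤-Reasoning

      -- The c ≤ k N factors lose at most 2k / (n N) each, which adds up to 2k² / n.
      cx≤ : ι c * x ≤ ι (k ℕ.* (2 ℕ.* k)) * u n
      cx≤ = ℚₚ.*-cancelʳ-≤-pos (ι D) {{ι-positive D}} (begin
        ι c * (ι (2 ℕ.* k) * u D) * ι D          ≡⟨ ℚₚ.*-assoc (ι c) x (ι D) ⟩
        ι c * (ι (2 ℕ.* k) * u D * ι D)          ≡⟨ cong (ι c *_) (*-u-cancelʳ (ι (2 ℕ.* k)) D) ⟩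
        ι c * ι (2 ℕ.* k)                        ≤⟨ *-monoʳ (ι (2 ℕ.* k)) (0≤ι (2 ℕ.* k)) (ι-mono-≤ c≤k*N) ⟩
        ι (k ℕ.* N) * ι (2 ℕ.* k)                ≡⟨ cong (_* ι (2 ℕ.* k)) (ι-* k N) ⟩
        ι k * ι N * ι (2 ℕ.* k)                  ≡⟨ ℚₚ.*-identityʳ _ ⟨
        ι k * ι N * ι (2 ℕ.* k) * 1ℚ             ≡⟨ cong (ι k * ι N * ι (2 ℕ.* k) *_) (u*ι n) ⟨
        ι k * ι N * ι (2 ℕ.* k) * (u n * ι n)    ≡⟨ solve 5 (λ k N h v n → k :* N :* h :* (v :* n) := k :* h :* v :* (n :* N))
                                                      refl (ι k) (ι N) (ι (2 ℕ.* k)) (u n) (ι n) ⟩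
        ι k * ι (2 ℕ.* k) * u n * (ι n * ι N)    ≡⟨ cong₂ (λ p q → p * u n * q) (ι-* k (2 ℕ.* k)) (ι-* n N) ⟨
        ι (k ℕ.* (2 ℕ.* k)) * u n * ι D          ∎)
        where
        open ℚₚ.≤-Reasoning
        open +-*-Solver
        c≤k*N : c ℕ.≤ k ℕ.* N
        c≤k*N = subst (c ℕ.≤_) (sym (ℕₚ.*-suc k n)) (ℕₚ.+-monoˡ-≤ (k ℕ.* n) (ℕₚ.≤-trans (s≤s z≤n) 2≤k))

    module _ (j : ℕ) (n<j : n ℕ.< j) where
      private
        E = eSum j
        z = ρ n ^ n * E

        0≤E^k : 0ℚ ≤ E ^ k
        0≤E^k = 0≤^ k (subst (λ i → 0ℚ ≤ eSum i) (ℕₚ.+-identityʳ j) (eSum-mono 0 j))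

        -- The exponent c = 1 + k n pairs each of the k factors E with n factors `ρ n`, leaving a
        -- single `ρ n` over.
        ρ^c*E^k : ρ n ^ c * E ^ k ≡ ρ n * z ^ k
        ρ^c*E^k = begin
          ρ n * ρ n ^ (k ℕ.* n) * E ^ k     ≡⟨ cong (λ i → ρ n * ρ n ^ i * E ^ k) (ℕₚ.*-comm k n) ⟩
          ρ n * ρ n ^ (n ℕ.* k) * E ^ k     ≡⟨ cong (λ p → ρ n * p * E ^ k) (^-assocʳ (ρ n) n k) ⟨
          ρ n * (ρ n ^ n) ^ k * E ^ k       ≡⟨ ℚₚ.*-assoc (ρ n) ((ρ n ^ n) ^ k) (E ^ k) ⟩
          ρ n * ((ρ n ^ n) ^ k * E ^ k)     ≡⟨ cong (ρ n *_) (^-distrib-* (ρ n ^ n) E k) ⟨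
          ρ n * z ^ k                       ∎
          where open ≡-Reasoning

        0≤z : 0ℚ ≤ z
        0≤z = ℚₚ.≤-trans 0≤1 (1≤ρ^n*e n j n<j)

      proportion*e^k≤ : expectedSafeProportion k (suc n) * eSum j ^ k ≤
        1ℚ + ι (proj₁ ([1+y]^k≤1+Ky k)) * u n
      proportion*e^k≤ = begin
        a * E ^ k             ≤⟨ *-monoʳ (E ^ k) 0≤E^k a≤ρ^c ⟩
        ρ n ^ c * E ^ k       ≡⟨ ρ^c*E^k ⟩
        ρ n * z ^ k           ≤⟨ *-monoʳ (z ^ k) (0≤^ k 0≤z) (ρ≤1 n) ⟩
        1ℚ * z ^ k            ≡⟨ ℚₚ.*-identityˡ (z ^ k) ⟩
        z ^ k                 ≤⟨ ^-mono-≤ k 0≤z (ρ^n*e≤1+y n j n<j) ⟩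
        (1ℚ + u n) ^ k        ≤⟨ proj₂ ([1+y]^k≤1+Ky k) (u n) (0≤u n) (u≤1 n) ⟩
        _                     ∎
        where open ℚₚ.≤-Reasoning

      -- Of the constant 2k² + 1, the part 2k² is the loss in Bernoulli's inequality and the 1 pays
      -- for the leftover `ρ n` = 1 - 1/N, as 1/N ≤ 1/n.
      1≤proportion*e^k : 1ℚ ≤ expectedSafeProportion k (suc n) * eSum j ^ k +
        ι (suc (k ℕ.* (2 ℕ.* k))) * u n
      1≤proportion*e^k = begin
        1ℚ                                          ≡⟨ ρ+u≡1 n ⟨
        ρ n + u N                                   ≡⟨ cong (_+ u N) (ℚₚ.*-identityʳ (ρ n)) ⟨
        ρ n * 1ℚ + u N                              ≤⟨ ℚₚ.+-mono-≤ (*-monoˡ (ρ n) (0≤ρ n) (bernoulli c 0≤s 0≤x s+x≡1)) (u-anti (ℕₚ.n≤1+n n)) ⟩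
        ρ n * (s ^ c + ι c * x) + u n               ≡⟨ cong (_+ u n) (ℚₚ.*-distribˡ-+ (ρ n) (s ^ c) (ι c * x)) ⟩
        ρ n * s ^ c + ρ n * (ι c * x) + u n         ≤⟨ ℚₚ.+-monoˡ-≤ (u n) (ℚₚ.+-mono-≤ main error) ⟩
        a * E ^ k + ι (k ℕ.* (2 ℕ.* k)) * u n + u n ≡⟨ ℚₚ.+-assoc (a * E ^ k) _ (u n) ⟩
        a * E ^ k + (ι (k ℕ.* (2 ℕ.* k)) * u n + u n) ≡⟨ cong (a * E ^ k +_) (ι-suc-* (k ℕ.* (2 ℕ.* k)) (u n)) ⟨
        a * E ^ k + ι (suc (k ℕ.* (2 ℕ.* k))) * u n ∎
        where
        open ℚₚ.≤-Reasoning
        open +-*-Solver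
        error : ρ n * (ι c * x) ≤ ι (k ℕ.* (2 ℕ.* k)) * u n
        error = begin
          ρ n * (ι c * x)     ≤⟨ *-monoʳ (ι c * x) (0≤* (0≤ι c) 0≤x) (ρ≤1 n) ⟩
          1ℚ * (ι c * x)      ≡⟨ ℚₚ.*-identityˡ (ι c * x) ⟩
          ι c * x             ≤⟨ cx≤ ⟩
          ι (k ℕ.* (2 ℕ.* k)) * u n ∎
        main : ρ n * s ^ c ≤ a * E ^ k
        main = begin
          ρ n * s ^ c                  ≡⟨ cong (_* s ^ c) (ℚₚ.*-identityʳ (ρ n)) ⟨
          ρ n * 1ℚ * s ^ c             ≤⟨ *-monoʳ (s ^ c) (0≤^ c 0≤s) (*-monoˡ (ρ n) (0≤ρ n) (1≤^ k (1≤ρ^n*e n j n<j))) ⟩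
          ρ n * z ^ k * s ^ c          ≡⟨ cong (_* s ^ c) ρ^c*E^k ⟨
          ρ n ^ c * E ^ k * s ^ c      ≡⟨ solve 3 (λ p q r → p :* q :* r := p :* r :* q) refl (ρ n ^ c) (E ^ k) (s ^ c) ⟩
          ρ n ^ c * s ^ c * E ^ k      ≡⟨ cong (_* E ^ k) (^-distrib-* (ρ n) s c) ⟨
          (ρ n * s) ^ c * E ^ k        ≤⟨ *-monoʳ (E ^ k) 0≤E^k [ρs]^c≤a ⟩
          a * E ^ k                    ∎

-- Division by the power of e, and the limit

open SeriesLemmas using (u; 0≤u; archimedean)
open RationalLemmas using (*-mono-nonNeg; ∣p∣≤; p≤q+r⇒p-q≤r; 0<*; 0<1)
open ReciprocalLemmas using (recip-inverse; ∣recip∣≤; apart⇒≢0)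
open PowerLemmas using (1≤e^k)
open RationalConversion
open Exponential
open Estimate
open import Algebra.Bundles using (CommutativeRing)
open import Data.Nat using (ℕ; suc; _≤_)
open import Data.Nat.Base as ℕ using (zero; NonZero; z≤n; s≤s)
import Data.Nat.Properties as ℕₚ
open import Data.Product.Base using (∃-syntax; _×_; _,_; proj₁; proj₂)
open import Data.Rational.Base as ℚ using (ℚ; 0ℚ; 1ℚ; _+_; _-_; _*_; -_; _<_) renaming (∣_∣ to ∣_∣ℚ)
import Data.Rational.Properties as ℚₚ
open import Data.Rational.Solver using (module +-*-Solver)
open import Relation.Binary.PropositionalEquality
open import Algebra.Properties.CommutativeSemiring.Exp
  (CommutativeRing.commutativeSemiring ℚₚ.+-*-commutativeRing)
  using (_^_)

seq-^ℝ : ∀ x k j → seq (x ^ℝ k) j ≡ seq x j ^ k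
seq-^ℝ x zero    j = refl
seq-^ℝ x (suc k) j = cong (seq x j *_) (seq-^ℝ x k j)

-- Since p - 1/q = (1/q) (p q - 1) and 1/q ≤ 1, dividing by q does not enlarge the error.
∣p-recip∣≤ : ∀ p q r → 1ℚ ℚ.≤ q → p * q ℚ.≤ 1ℚ + r → 1ℚ ℚ.≤ p * q + r → ∣ p - recip q ∣ℚ ℚ.≤ r
∣p-recip∣≤ p q r 1≤q upper lower = begin
  ∣ p - w ∣ℚ                      ≡⟨ cong₂ (λ a b → ∣ a - b ∣ℚ) p≡ (sym (ℚₚ.*-identityʳ w)) ⟩
  ∣ w * (p * q) - w * 1ℚ ∣ℚ       ≡⟨ cong ∣_∣ℚ (factor w (p * q)) ⟩
  ∣ w * (p * q - 1ℚ) ∣ℚ           ≡⟨ ℚₚ.∣p*q∣≡∣p∣*∣q∣ w (p * q - 1ℚ) ⟩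
  ∣ w ∣ℚ * ∣ p * q - 1ℚ ∣ℚ        ≤⟨ *-mono-nonNeg (ℚₚ.0≤∣p∣ (p * q - 1ℚ)) 0≤1
                                       (∣recip∣≤ 1ℚ 0<1 q 1≤∣q∣)
                                       (∣p∣≤ {p * q - 1ℚ} (p≤q+r⇒p-q≤r 1ℚ upper)
                                         (subst (ℚ._≤ r) (swap (p * q)) (p≤q+r⇒p-q≤r (p * q) lower))) ⟩
  1ℚ * r                          ≡⟨ ℚₚ.*-identityˡ r ⟩
  r                               ∎
  where
  open ℚₚ.≤-Reasoning
  open +-*-Solver
  w = recip q
  1≤∣q∣ : 1ℚ ℚ.≤ ∣ q ∣ℚ
  1≤∣q∣ = subst (1ℚ ℚ.≤_) (sym (ℚₚ.0≤p⇒∣p∣≡p (ℚₚ.≤-trans 0≤1 1≤q))) 1≤q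
  p≡ : p ≡ w * (p * q)
  p≡ = trans (sym (ℚₚ.*-identityʳ p)) (trans (cong (p *_) (sym (recip-inverse q (apart⇒≢0 0<1 1≤∣q∣))))
    (solve 3 (λ p w q → p :* (w :* q) := w :* (p :* q)) refl p w q))
  factor : ∀ w a → w * a - w * 1ℚ ≡ w * (a - 1ℚ)
  factor = solve 2 (λ w a → w :* a :- w :* con 1ℚ := w :* (a :- con 1ℚ)) refl
  swap : ∀ a → 1ℚ - a ≡ - (a - 1ℚ)
  swap = solve 1 (λ a → con 1ℚ :- a := :- (a :- con 1ℚ)) refl

-- The rate K + 1 over n holds for all j > n at once, because `_<ℝ_` compares all late terms of the
-- two sequences with one fixed gap. The form `suc K` keeps the constant positive, so that δ can be
-- divided by it.
estimate : ∀ k → 2 ≤ k → ∃[ K ] (∀ n .{{_ : NonZero n}} → 2 ℕ.* k ≤ n → ∀ j → n ℕ.< j →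
  ∣ expectedSafeProportion k (suc n) - recip (seq (e ^ℝ k) j) ∣ℚ ℚ.≤ ι (suc K) * u n)
estimate k 2≤k = K₁ ℕ.+ K₂ , λ n 2k≤n j n<j →
  ∣p-recip∣≤ (expectedSafeProportion k (suc n)) (seq (e ^ℝ k) j) _
    (1≤e^k k j (ℕₚ.≤-trans (s≤s z≤n) n<j))
    (subst (λ q → expectedSafeProportion k (suc n) * q ℚ.≤ 1ℚ + ι (suc (K₁ ℕ.+ K₂)) * u n) (sym (seq-^ℝ e k j))
      (ℚₚ.≤-trans (proportion*e^k≤ k n 2≤k 2k≤n j n<j)
        (ℚₚ.+-monoʳ-≤ 1ℚ (weaken n (ℕₚ.m≤n⇒m≤1+n (ℕₚ.m≤m+n K₁ K₂))))))
    (subst (λ q → 1ℚ ℚ.≤ expectedSafeProportion k (suc n) * q + ι (suc (K₁ ℕ.+ K₂)) * u n) (sym (seq-^ℝ e k j))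
      (ℚₚ.≤-trans (1≤proportion*e^k k n 2≤k 2k≤n j n<j)
        (ℚₚ.+-monoʳ-≤ (expectedSafeProportion k (suc n) * eSum j ^ k) (weaken n (s≤s (ℕₚ.m≤n+m K₂ K₁))))))
  where
  K₁ = proj₁ ([1+y]^k≤1+Ky k)
  K₂ = k ℕ.* (2 ℕ.* k)
  weaken : ∀ n .{{_ : NonZero n}} {a b} → a ≤ b → ι a * u n ℚ.≤ ι b * u n
  weaken n a≤b = *-monoʳ (u n) (0≤u n) (ι-mono-≤ a≤b)

0<u : ∀ n .{{_ : NonZero n}} → 0ℚ < u n
0<u n = ℚₚ.positive⁻¹ (u n) {{ℚₚ.normalize-pos 1 n}}

double-cancel : ∀ c δ .{{_ : NonZero (c ℕ.+ c)}} →
  ι c * (δ * u (c ℕ.+ c)) + ι c * (δ * u (c ℕ.+ c)) ≡ δ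
double-cancel c δ = begin
  ι c * (δ * v) + ι c * (δ * v)      ≡⟨ rearrange (ι c) δ v ⟩
  δ * v * (ι c + ι c)                ≡⟨ cong (δ * v *_) (ι-+ c c) ⟨
  δ * v * ι (c ℕ.+ c)                ≡⟨ *-u-cancelʳ δ (c ℕ.+ c) ⟩
  δ                                  ∎
  where
  open ≡-Reasoning
  v = u (c ℕ.+ c)
  rearrange : ∀ c d v → c * (d * v) + c * (d * v) ≡ d * v * (c + c)
  rearrange = solve 3 (λ c d v → c :* (d :* v) :+ c :* (d :* v) := d :* v :* (c :+ c)) refl
    where open +-*-Solver

-- Half of δ is spent on the distance, the other half is the gap that _<ℝ_ asks for.
eventually-within : ∀ δ → 0ℚ < δ → ∀ K →
  ∃[ η ] 0ℚ < η × (∃[ N ] (∀ n .{{_ : NonZero n}} → N ≤ n → ι (suc K) * u n + η ℚ.≤ δ))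
eventually-within δ 0<δ K = η , 0<η , suc N , λ n N<n → ℚₚ.≤-trans
  (ℚₚ.+-monoˡ-≤ η (*-monoˡ (ι (suc K)) (0≤ι (suc K)) (ℚₚ.≤-trans (u-anti N<n) (ℚₚ.<⇒≤ (proj₂ arch)))))
  (ℚₚ.≤-reflexive (double-cancel (suc K) δ))
  where
  v = δ * u (suc K ℕ.+ suc K)
  0<v : 0ℚ < v
  0<v = 0<* 0<δ (0<u (suc K ℕ.+ suc K))
  η = ι (suc K) * v
  0<η : 0ℚ < η
  0<η = 0<* (ℚₚ.positive⁻¹ (ι (suc K)) {{ι-positive (suc K)}}) 0<v
  arch = archimedean v 0<v
  N = proj₁ arch

mainTheorem5 : (k : ℕ) → 2 ≤ k →
    (λ n → fromℚ (expectedSafeProportion k (suc n))) ⟶ invℝ (e ^ℝ k) (e^k≠0 k)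
mainTheorem5 k 2≤k ε (δ , 0<δ , J , δ≤ε) = 1 ℕ.⊔ (N ℕ.⊔ 2 ℕ.* k) , λ n h →
    -- The threshold for j may depend on n: past J the terms of ε are at least δ, and j > n makes
    -- the partial sum of e long enough.
    η , proj₁ (proj₂ slack) , J ℕ.⊔ suc n , λ j J≤j → within-ε n j
      (ℕₚ.m⊔n≤o⇒m≤o 1 (N ℕ.⊔ 2 ℕ.* k) h)
      (ℕₚ.m⊔n≤o⇒m≤o N (2 ℕ.* k) (ℕₚ.m⊔n≤o⇒n≤o 1 (N ℕ.⊔ 2 ℕ.* k) h)) (ℕₚ.m⊔n≤o⇒n≤o N (2 ℕ.* k) (ℕₚ.m⊔n≤o⇒n≤o 1 (N ℕ.⊔ 2 ℕ.* k) h))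
      (ℕₚ.m⊔n≤o⇒m≤o J (suc n) J≤j) (ℕₚ.m⊔n≤o⇒n≤o J (suc n) J≤j)
  where
  K = proj₁ (estimate k 2≤k)
  slack = eventually-within δ 0<δ K
  η = proj₁ slack
  N = proj₁ (proj₂ (proj₂ slack))
  within-ε : ∀ n j → 1 ≤ n → N ≤ n → 2 ℕ.* k ≤ n → J ≤ j → n ℕ.< j →
    ∣ expectedSafeProportion k (suc n) - recip (seq (e ^ℝ k) j) ∣ℚ + η ℚ.≤ seq ε j
  within-ε n j 1≤n N≤n 2k≤n J≤j n<j = begin
    ∣ expectedSafeProportion k (suc n) - recip (seq (e ^ℝ k) j) ∣ℚ + η
                               ≤⟨ ℚₚ.+-monoˡ-≤ η (proj₂ (estimate k 2≤k) n 2k≤n j n<j) ⟩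
    ι (suc K) * u n + η        ≤⟨ proj₂ (proj₂ (proj₂ slack)) n N≤n ⟩
    δ                          ≡⟨ ℚₚ.+-identityˡ δ ⟨
    0ℚ + δ                     ≤⟨ δ≤ε j J≤j ⟩
    seq ε j                    ∎
    where
    open ℚₚ.≤-Reasoning
    instance _ = ℕ.>-nonZero 1≤n
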